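{- There is an absolute constant $C>0$ such that for every integer $n\ge 2$ and any distinct strings $x,y\in\{0,1\}^n$, there is a deterministic finite automaton with at most $C\,n^{1/3}\log^7 n$ states that accepts $x$ but does not accept $y$.
   Context: A deterministic finite automaton (DFA) is a 4-tuple $(Q,\delta,q_1,F)$ consisting of a finite set $Q$ (the states), a function $\delta:Q\times\{0,1\}\to Q$, an element $q_1\in Q$ (the initial state), and a subset $F\subseteq Q$ (the accept states). It accepts a string $x=x_1,\dots,x_n\in\{0,1\}^n$ if and only if the sequence defined by $r_1=q_1$ and $r_{i+1}=\delta(r_i,x_i)$ for $1\le i\le n$ satisfies $r_{n+1}\in F$. The number of states is $|Q|$. Here $\log$ is the natural logarithm and $\log^7 n=(\log n)^7$. -}

module Defs where

open import Algebra.Bundles using (CommutativeRing)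
open import Data.Bool using (Bool)
open import Data.Fin using (Fin)
open import Data.Integer using (+_)
open import Data.Nat as ℕ using (ℕ; zero; suc; _!)
import Data.Nat.Properties as ℕ
open import Data.Product using (∃₂; ∃-syntax; _×_; _,_; proj₁; proj₂)
open import Data.Rational
open import Data.Rational.Properties
open import Data.Sum using (_⊎_; inj₁; inj₂)
open import Data.Vec using (Vec; foldl′)
open import Function using (_↔_)
open import Level using (0ℓ)
open import Relation.Binary.PropositionalEquality
open import Relation.Nullary using (yes; no)
open import Relation.Unary using (Pred; _∈_)

open import Algebra.Properties.Semiring.Exp
  (CommutativeRing.semiring +-*-commutativeRing) using (_^_)

------------------------------------------------------------------------
-- Deterministic finite automata over {0,1}

record DFA : Set₁ where
  field
    Q      : Set
    ∣Q∣    : ℕ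
    finite : Q ↔ Fin ∣Q∣
    δ      : Q × Bool → Q
    q₁     : Q
    F      : Pred Q 0ℓ

Accepts : ∀ {n} → DFA → Vec Bool n → Set
Accepts M x = foldl′ (λ r b → δ (r , b)) q₁ x ∈ F
  where open DFA M

------------------------------------------------------------------------
-- Non-negative real numbers

-- A real x ≥ 0 is given by its Dedekind cut { q ∈ ℚ ∣ q < x }.  Only the
-- lower half is recorded, and the order is inclusion of lower halves.

record ℝ≥0 : Set₁ where
  field
    Below    : Pred ℚ 0ℓ
    below-0  : ∀ {q} → q < 0ℚ → q ∈ Below
    bounded  : ∃[ b ] ∀ {q} → q ∈ Below → q ≤ b
    downward : ∀ {p q} → p < q → q ∈ Below → p ∈ Below
    rounded  : ∀ {q} → q ∈ Below → ∃[ r ] q < r × r ∈ Below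

open ℝ≥0

infix 4 _≤ʳ_

_≤ʳ_ : ℝ≥0 → ℝ≥0 → Set
x ≤ʳ y = ∀ {q} → q ∈ Below x → q ∈ Below y

Positiveʳ : ℝ≥0 → Set
Positiveʳ x = 0ℚ ∈ Below x

-- The supremum of S ∪ {0}; every S used below has elements ≥ 0, except
-- that S is empty for a product with a factor 0 and for log 0.

sup : (S : Pred ℚ 0ℓ) → (∃[ b ] ∀ {q} → q ∈ S → q ≤ b) → ℝ≥0
sup S (b , S≤b) = record
  { Below    = λ q → q < 0ℚ ⊎ ∃[ p ] p ∈ S × q < p
  ; below-0  = inj₁
  ; bounded  = b ⊔ 0ℚ , λ where
      (inj₁ q<0)             → ≤-trans (<⇒≤ q<0) (p≤q⊔p b 0ℚ)
      (inj₂ (p , p∈S , q<p)) → ≤-trans (<⇒≤ q<p) (≤-trans (S≤b p∈S) (p≤p⊔q b 0ℚ))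
  ; downward = λ where
      p<q (inj₁ q<0)             → inj₁ (<-trans p<q q<0)
      p<q (inj₂ (s , s∈S , q<s)) → inj₂ (s , s∈S , <-trans p<q q<s)
  ; rounded  = λ where
      (inj₁ q<0) → let r , q<r , r<0 = <-dense q<0 in r , q<r , inj₁ r<0
      (inj₂ (s , s∈S , q<s)) →
        let r , q<r , r<s = <-dense q<s in r , q<r , inj₂ (s , s∈S , r<s)
  }

fromℕ : ℕ → ℝ≥0
fromℕ k = sup (_≡ + k / 1) (+ k / 1 , ≤-reflexive)

*-bound : ∀ {p q b c} → 0ℚ ≤ p → 0ℚ ≤ q → p ≤ b → q ≤ c → p * q ≤ b * c
*-bound {p} {q} {b} {c} 0≤p 0≤q p≤b q≤c = ≤-trans
  (*-monoʳ-≤-nonNeg q {{nonNegative 0≤q}} p≤b)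
  (*-monoˡ-≤-nonNeg b {{nonNegative (≤-trans 0≤p p≤b)}} q≤c)

infixl 7 _*ʳ_
infixr 8 _^ʳ_

_*ʳ_ : ℝ≥0 → ℝ≥0 → ℝ≥0
x *ʳ y = sup Products (proj₁ (bounded x) * proj₁ (bounded y) , bound)
  where
  Products : Pred ℚ 0ℓ
  Products r = ∃₂ λ p q →
    0ℚ ≤ p × p ∈ Below x × 0ℚ ≤ q × q ∈ Below y × r ≡ p * q

  bound : ∀ {r} → r ∈ Products → r ≤ proj₁ (bounded x) * proj₁ (bounded y)
  bound (p , q , 0≤p , p<x , 0≤q , q<y , refl) =
    *-bound 0≤p 0≤q (proj₂ (bounded x) p<x) (proj₂ (bounded y) q<y)

_^ʳ_ : ℝ≥0 → ℕ → ℝ≥0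
x ^ʳ zero  = fromℕ 1
x ^ʳ suc k = x *ʳ x ^ʳ k

cbrt : ℕ → ℝ≥0
cbrt n = sup (λ q → 0ℚ ≤ q × q ^ 3 ≤ + n / 1) (1ℚ ⊔ (+ n / 1) , bound)
  where
  bound : ∀ {q} → 0ℚ ≤ q × q ^ 3 ≤ + n / 1 → q ≤ 1ℚ ⊔ (+ n / 1)
  bound {q} (0≤q , q³≤n) with q ≤? 1ℚ
  ... | yes q≤1 = ≤-trans q≤1 (p≤p⊔q 1ℚ (+ n / 1))
  ... | no  q≰1 = ≤-trans q≤q³ (≤-trans q³≤n (p≤q⊔p 1ℚ (+ n / 1)))
    where
    1≤q = <⇒≤ (≰⇒> q≰1)
    0≤1 : 0ℚ ≤ 1ℚ
    0≤1 = nonNegative⁻¹ 1ℚ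
    1≤q² : 1ℚ ≤ q ^ 2
    1≤q² = *-bound {1ℚ} {1ℚ} 0≤1 0≤1 1≤q
             (≤-trans 1≤q (≤-reflexive (sym (*-identityʳ q))))
    q≤q³ : q ≤ q ^ 3
    q≤q³ = ≤-trans (≤-reflexive (sym (*-identityʳ q)))
             (*-bound 0≤q 0≤1 ≤-refl 1≤q²)

-- expSum q N = Σ_{j ≤ N} qʲ / j!
expSum : ℚ → ℕ → ℚ
expSum q zero    = 1ℚ
expSum q (suc N) = expSum q N + q ^ suc N * (+ 1 / (suc N !)) {{suc N ℕ.!≢0}}

-- The natural logarithm of n ≥ 1 as the supremum of the rationals q ≥ 0
-- with exp q ≤ n.  For q ≥ 0 the partial sums of exp q increase to exp q,
-- so exp q ≤ n means that all of them are ≤ n.  (log 0 is 0 here.)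
log : ℕ → ℝ≥0
log n = sup (λ q → 0ℚ ≤ q × (∀ N → expSum q N ≤ + n / 1)) (+ n / 1 , bound)
  where
  bound : ∀ {q} → 0ℚ ≤ q × (∀ N → expSum q N ≤ + n / 1) → q ≤ + n / 1
  bound {q} (0≤q , expq≤n) = ≤-trans q≤1+q (expq≤n 1)
    where
    q≤1+q : q ≤ expSum q 1
    q≤1+q = begin
      q                        ≡⟨ +-identityˡ q ⟨
      0ℚ + q                   ≤⟨ +-monoˡ-≤ q (nonNegative⁻¹ 1ℚ) ⟩
      1ℚ + q                   ≡⟨ cong (_+_ 1ℚ) (*-identityʳ q) ⟨
      1ℚ + q * 1ℚ              ≡⟨ cong (_+_ 1ℚ) (*-identityʳ (q * 1ℚ)) ⟨
      1ℚ + q * 1ℚ * 1ℚ         ∎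
      where open ≤-Reasoning

{-# OPTIONS --safe #-}

-- Suppose that a pattern occurs at equally many positions of x and of y in
-- every residue class modulo r.  If α, β indicate its occurrences, then r
-- divides D = Σ (α(s) - β(s)) h(s) for each integer polynomial h.  The
-- pattern is chosen with length about n^(1/3), ending at the first position
-- where x and y differ and without short periods, so that its occurrences
-- in either word are about n^(1/3) apart.  For h take a Chebyshev
-- polynomial of degree about n^(1/3) log n, bounded beyond distance n^(1/3)
-- from the first difference and steeply decreasing up to there: then D ≠ 0,
-- while log |D| is about n^(1/3) log² n.  Since lcm(1, …, k) grows
-- exponentially, some r of size n^(1/3) log² n does not divide D, so some
-- two counts differ, and they still do so modulo some q = O(log n).  As the
-- pattern is shorter than r, the count is computed with 2rq states: the
-- position modulo r, one bit for the current match, and the count modulo q.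

module Submission where

-- Why the exponent is 1/3: let `L` be the guaranteed distance between occurrences. The pattern then
-- has 2L + 1 letters, and a single bit can follow it only if windows opened every r letters do not
-- overlap, so r must be at least of order L. On the other hand, T_d(1 + δ) starts to grow only when
-- d² δ reaches a constant. A polynomial that is bounded on an interval of length about n and large
-- at distance L outside it thus needs degree about sqrt(n / L), times a logarithm so that one value
-- outweighs about n bounded terms. The two costs balance at L about n^(1/3). A large value at the
-- first difference is not enough: separation still allows the other word one occurrence within
-- distance `L`, perhaps at the very next position. What has to be large is therefore the drop of h
-- from one position to the next. No real number enters before the very end. With 8^m ≤ n < 8^(m+1),
-- lengths and bounds are powers of two, and so is the degree of h. Hence h is an iterate of 2x² -
-- 1, and every estimate on it is a polynomial inequality over ℤ, carried through one iteration at a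
-- time.

-- Common multiples of 1, ..., n are exponentially large.

module CommonMultiples where

  open import Data.Nat
  open import Data.Nat.Properties
  open import Data.Nat.Divisibility
  open import Data.Nat.Combinatorics using (_C_; nCk+nC[k+1]≡[n+1]C[k+1]; nCn≡1)
  open import Data.Nat.Tactic.RingSolver using (solve-∀)
  open import Data.Product using (∃-syntax; _×_; _,_)
  open import Relation.Binary.PropositionalEquality
  open import Relation.Nullary


  pascal : ∀ n k → suc n C suc k ≡ n C k + n C suc k
  pascal n k = sym (nCk+nC[k+1]≡[n+1]C[k+1] n k)

  absorption : ∀ n k → suc k * (suc n C suc k) ≡ suc n * (n C k)
  absorption zero zero = refl
  absorption zero (suc k) = *-zeroʳ (2 + k)
  absorption (suc n) zero = begin
    1 * (suc (suc n) C 1)             ≡⟨ cong (1 *_) (pascal (suc n) 0) ⟩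
    1 * (1 + suc n C 1)         ≡⟨ l (suc n C 1) ⟩
    1 + 1 * (suc n C 1)         ≡⟨ cong (1 +_) (absorption n 0) ⟩
    (2 + n) * 1 ∎
    where
    open ≡-Reasoning
    l : ∀ x → 1 * (1 + x) ≡ 1 + 1 * x
    l = solve-∀
  absorption (suc n) (suc k) = begin
    (2 + k) * (suc (suc n) C suc (suc k))                                ≡⟨ cong ((2 + k) *_) (pascal (suc n) (suc k)) ⟩
    (2 + k) * (suc n C suc k + suc n C suc (suc k))              ≡⟨ l₁ (suc k) (suc n C suc k) _ ⟩
    (suc n C suc k) + suc k * (suc n C suc k) + (2 + k) * (suc n C suc (suc k))
      ≡⟨ cong₂ (λ a b → (suc n C suc k) + a + b) (absorption n k) (absorption n (suc k)) ⟩
    (suc n C suc k) + suc n * (n C k) + suc n * (n C suc k)  ≡⟨ l₂ (suc n C suc k) (suc n) (n C k) _ ⟩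
    (suc n C suc k) + suc n * (n C k + n C suc k)            ≡⟨ cong (λ a → (suc n C suc k) + suc n * a) (pascal n k) ⟨
    (2 + n) * (suc n C suc k) ∎
    where
    open ≡-Reasoning
    l₁ : ∀ k a b → suc k * (a + b) ≡ a + k * a + suc k * b
    l₁ = solve-∀
    l₂ : ∀ a n b c → a + n * b + n * c ≡ a + n * (b + c)
    l₂ = solve-∀

  -- The identity (n + 1 - k) C(n + 1, k) = (n + 1) C(n, k), with the subtracted term moved to the
  -- other side so that it holds in ℕ for every `k`.
  absorption′ : ∀ n k → suc n * (n C k) + k * (suc n C k) ≡ suc n * (suc n C k)
  absorption′ n zero = +-identityʳ _
  absorption′ n (suc k) = begin
    suc n * (n C suc k) + suc k * (suc n C suc k) ≡⟨ cong (suc n * (n C suc k) +_) (absorption n k) ⟩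
    suc n * (n C suc k) + suc n * (n C k)         ≡⟨ *-distribˡ-+ (suc n) (n C suc k) _ ⟨
    suc n * (n C suc k + n C k)                   ≡⟨ cong (suc n *_) (+-comm (n C suc k) _) ⟩
    suc n * (n C k + n C suc k)                   ≡⟨ cong (suc n *_) (pascal n k) ⟨
    suc n * (suc n C suc k) ∎
    where open ≡-Reasoning

  CommonMultiple : ℕ → ℕ → Set
  CommonMultiple n D = ∀ r → 1 ≤ r → r ≤ n → r ∣ D

  -- In Leibniz's harmonic triangle, with entries 1/((n+1)·C(n,k)), every
  -- entry is the one above it minus its right neighbour, so all entries are
  -- integer combinations of 1/1, …, 1/(n+1).
  leibniz-triangle : ∀ {D} → D ≢ 0 → ∀ e k → CommonMultiple (suc (e + k)) D →
                     suc (e + k) * ((e + k) C k) ∣ D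
  leibniz-triangle {D} D≢0 zero k mult =
    subst (λ c → suc k * c ∣ D) (sym (nCn≡1 k))
      (subst (_∣ D) (sym (*-identityʳ (suc k))) (mult (suc k) (s≤s z≤n) ≤-refl))
  leibniz-triangle {D} D≢0 (suc e) k mult
    with leibniz-triangle D≢0 e k (λ r 1≤r r≤ → mult r 1≤r (m≤n⇒m≤1+n r≤))
       | subst (λ i → suc i * (i C suc k) ∣ D) (+-suc e k)
           (leibniz-triangle D≢0 e (suc k) (subst (λ i → CommonMultiple (suc i) D) (sym (+-suc e k)) mult))
  -- `s` and `t` are `D` times the entry above and `D` times the right neighbour, so `s ∸ t` is `D`
  -- times the wanted entry.
  ... | divides s D≡sA | divides t D≡tB = divides (s ∸ t) (sym (begin
      (s ∸ t) * (suc (suc n) * X)           ≡⟨ *-distribʳ-∸ (suc (suc n) * X) s t ⟩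
      s * (suc (suc n) * X) ∸ t * (suc (suc n) * X) ≡⟨ cong₂ _∸_ eq₁ eq₂ ⟩
      (D + suc k * s * X) ∸ suc k * s * X   ≡⟨ m+n∸n≡m D (suc k * s * X) ⟩
      D ∎))
    where
    open ≡-Reasoning
    n = e + k
    A = suc n * (n C k)
    X = suc n C k
    A≢0 : A ≢ 0
    A≢0 A≡0 = D≢0 (trans D≡sA (trans (cong (s *_) A≡0) (*-zeroʳ s)))
    ks≡nt : suc k * s ≡ suc (suc n) * t
    ks≡nt = *-cancelʳ-≡ (suc k * s) (suc (suc n) * t) A {{≢-nonZero A≢0}} (begin
      suc k * s * A                          ≡⟨ *-assoc (suc k) s A ⟩
      suc k * (s * A)                        ≡⟨ cong (suc k *_) (trans (sym D≡sA) D≡tB) ⟩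
      suc k * (t * (suc (suc n) * (suc n C suc k))) ≡⟨ l (suc k) t (suc (suc n)) _ ⟩
      suc (suc n) * t * (suc k * (suc n C suc k)) ≡⟨ cong (suc (suc n) * t *_) (absorption n k) ⟩
      suc (suc n) * t * A                    ∎)
      where
      l : ∀ k t n x → k * (t * (n * x)) ≡ n * t * (k * x)
      l = solve-∀
    eq₁ : s * (suc (suc n) * X) ≡ D + suc k * s * X
    eq₁ = begin
      s * (suc (suc n) * X)                 ≡⟨ l s (suc n) X ⟩
      s * (suc n * X) + s * X               ≡⟨ cong (λ a → s * a + s * X) (absorption′ n k) ⟨
      s * (A + k * X) + s * X               ≡⟨ l′ s A k X ⟩
      s * A + suc k * s * X                 ≡⟨ cong (_+ suc k * s * X) D≡sA ⟨
      D + suc k * s * X                     ∎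
      where
      l : ∀ s n x → s * (suc n * x) ≡ s * (n * x) + s * x
      l = solve-∀
      l′ : ∀ s a k x → s * (a + k * x) + s * x ≡ s * a + suc k * s * x
      l′ = solve-∀
    eq₂ : t * (suc (suc n) * X) ≡ suc k * s * X
    eq₂ = trans (l t (suc (suc n)) X) (cong (_* X) (sym ks≡nt))
      where
      l : ∀ t n x → t * (n * x) ≡ n * t * x
      l = solve-∀

  nCk≤[1+n]Ck : ∀ n k → n C k ≤ suc n C k
  nCk≤[1+n]Ck n zero    = ≤-refl
  nCk≤[1+n]Ck n (suc k) = subst (n C suc k ≤_) (sym (pascal n k)) (m≤n+m _ (n C k))

  2^k≤[2k]Ck : ∀ k → 2 ^ k ≤ (k + k) C k
  2^k≤[2k]Ck zero    = ≤-refl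
  2^k≤[2k]Ck (suc k) = begin
    2 * 2 ^ k                          ≤⟨ *-monoʳ-≤ 2 (2^k≤[2k]Ck k) ⟩
    2 * X                              ≡⟨ cong (X +_) (+-identityʳ X) ⟩
    X + X                              ≤⟨ +-mono-≤ step₁ step₂ ⟩
    suc (k + k) C k + suc (k + k) C suc k ≡⟨ pascal (suc (k + k)) k ⟨
    suc (suc (k + k)) C suc k          ≡⟨ cong (λ i → suc i C suc k) (+-suc k k) ⟨
    (suc k + suc k) C suc k            ∎
    where
    open ≤-Reasoning
    X = (k + k) C k
    step₁ = nCk≤[1+n]Ck (k + k) k
    step₂ : X ≤ suc (k + k) C suc k
    step₂ = subst (X ≤_) (sym (pascal (k + k) k)) (m≤m+n X _)

  -- The middle entry of row 2k of the Leibniz triangle shows that (2k + 1) C(2k, k) divides `D`.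
  commonMultiple-large : ∀ {D} → D ≢ 0 → ∀ k → CommonMultiple (suc (k + k)) D → 2 ^ k ≤ D
  commonMultiple-large {D} D≢0 k mult = ≤-trans (2^k≤[2k]Ck k) (≤-trans (m≤n*m _ (suc (k + k)))
    (∣⇒≤ {{≢-nonZero D≢0}} (leibniz-triangle D≢0 k k mult)))

  -- Applied twice: to the weighted sum, which yields the modulus for positions, and to the
  -- difference of two counts, which yields the modulus of the counter.
  nonDivisor : ∀ {D} → D ≢ 0 → ∀ k → D < 2 ^ k → ∃[ r ] 1 ≤ r × r ≤ suc (k + k) × ¬ r ∣ D
  nonDivisor {D} D≢0 k D<2^k with anyUpTo? (λ r → ¬? (suc r ∣? D)) (suc (k + k))
  ... | yes (r , r< , r∤D) = suc r , s≤s z≤n , r< , r∤D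
  ... | no ∄ = contradiction D<2^k (≤⇒≯ (commonMultiple-large D≢0 k all))
    where
    all : CommonMultiple (suc (k + k)) D
    all (suc r) _ r≤ with suc r ∣? D
    ... | yes p = p
    ... | no ¬p = contradiction (r , r≤ , ¬p) ∄

-- Counting the occurrences of a pattern in one residue class with finite memory.

module PatternCounting where

  open import Data.Bool using (Bool; true; false; _∧_; _∨_; if_then_else_)
  import Data.Bool.Properties as Bool
  open import Data.Fin using (Fin; toℕ)
  open import Data.Fin.Properties using (toℕ-fromℕ<; toℕ<n)
  open import Data.Nat
  open import Data.Nat.Properties
  open import Data.Nat.DivMod using (_%_; _mod_; m<n⇒m%n≡m; m%n<n; n%n≡0; m%n%n≡m%n; %-distribˡ-+)
  open import Data.List using (List; []; _∷_; length; drop; foldl)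
  open import Data.Maybe using (Maybe; just; nothing)
  open import Data.Maybe.Properties using (just-injective)
  open import Data.Product using (_×_; _,_)
  open import Data.Sum using (inj₁; inj₂; _⊎_)
  open import Function using (_∘_)
  open import Relation.Binary.PropositionalEquality
  open import Relation.Nullary
  open import Relation.Nullary.Decidable using (does; dec-true; dec-false)


  bit : Bool → ℕ
  bit true  = 1
  bit false = 0

  _==_ : Bool → Bool → Bool
  b == c = does (b Bool.≟ c)

  at : List Bool → ℕ → Maybe Bool
  at []       i       = nothing
  at (b ∷ xs) zero    = just b
  at (b ∷ xs) (suc i) = at xs i

  at-drop : ∀ s xs i → at (drop s xs) i ≡ at xs (s + i)
  at-drop zero    xs       i = refl
  at-drop (suc s) []       i = refl
  at-drop (suc s) (b ∷ xs) i = at-drop s xs i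

  -- Σ α(s) over s < n with r ∣ c + s
  residueSum : (r : ℕ) .{{_ : NonZero r}} → ℕ → ℕ → (ℕ → ℕ) → ℕ
  residueSum r c zero    α = 0
  residueSum r c (suc n) α =
    (if does (c ≟ 0) then α 0 else 0) + residueSum r (suc c % r) n (α ∘ suc)

  %-+ʳ : ∀ a b q .{{_ : NonZero q}} → (a + b % q) % q ≡ (a + b) % q
  %-+ʳ a b q = begin
    (a + b % q) % q           ≡⟨ %-distribˡ-+ a (b % q) q ⟩
    (a % q + b % q % q) % q   ≡⟨ cong (λ x → (a % q + x) % q) (m%n%n≡m%n b q) ⟩
    (a % q + b % q) % q       ≡⟨ %-distribˡ-+ a b q ⟨
    (a + b) % q ∎
    where open ≡-Reasoning

  -- The pattern is w 0 … w W.
  module Pattern (W : ℕ) (w : ℕ → Bool) where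

    -- The offset `k` expresses what is left of a partly read window: after `k` letters it is
    -- `matches k l` with `k + l ≡ suc W`.
    matches : ℕ → ℕ → List Bool → Bool
    matches k zero    xs       = true
    matches k (suc l) []       = false
    matches k (suc l) (b ∷ xs) = (b == w k) ∧ matches (suc k) l xs

    matches-true : ∀ k l xs → (∀ i → i < l → at xs i ≡ just (w (k + i))) → matches k l xs ≡ true
    matches-true k zero    xs       eq = refl
    matches-true k (suc l) []       eq with () ← eq 0 (s≤s z≤n)
    matches-true k (suc l) (b ∷ xs) eq
      rewrite dec-true (b Bool.≟ w k) (trans (just-injective (eq 0 (s≤s z≤n))) (cong w (+-identityʳ k)))
      = matches-true (suc k) l xs λ i i<l → trans (eq (suc i) (s≤s i<l)) (cong (just ∘ w) (+-suc k i))

    true-matches : ∀ k l xs → matches k l xs ≡ true → ∀ i → i < l → at xs i ≡ just (w (k + i))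
    true-matches k (suc l) (b ∷ xs) eq i i<l with b Bool.≟ w k
    true-matches k (suc l) (b ∷ xs) eq zero    i<l       | yes b≡ = cong just (trans b≡ (cong w (sym (+-identityʳ k))))
    true-matches k (suc l) (b ∷ xs) eq (suc i) (s≤s i<l) | yes b≡ =
      trans (true-matches (suc k) l xs eq i i<l) (cong (just ∘ w) (sym (+-suc k i)))

    occurs : List Bool → ℕ → Bool
    occurs xs s = matches 0 (suc W) (drop s xs)

    occurs-true : ∀ xs s → (∀ i → i ≤ W → at xs (s + i) ≡ just (w i)) → occurs xs s ≡ true
    occurs-true xs s eq = matches-true 0 (suc W) (drop s xs) λ { i (s≤s i≤W) → trans (at-drop s xs i) (eq i i≤W) }

    true-occurs : ∀ xs s → occurs xs s ≡ true → ∀ i → i ≤ W → at xs (s + i) ≡ just (w i)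
    true-occurs xs s eq i i≤W = trans (sym (at-drop s xs i)) (true-matches 0 (suc W) (drop s xs) eq i (s≤s i≤W))

    -- Reading a letter in phase c, where f records that the letters read in
    -- phases 0, …, c - 1 agree with the pattern (and is junk when c > W).
    module Counter (r q : ℕ) .{{_ : NonZero r}} .{{_ : NonZero q}} where

      flag : ℕ → Bool → Bool → Bool
      flag c f b = (f ∨ does (c ≟ 0)) ∧ (b == w c)

      fires : ℕ → Bool → List Bool → ℕ
      fires c f []       = 0
      fires c f (b ∷ xs) = bit (does (c ≟ W) ∧ flag c f b) + fires (suc c % r) (flag c f b) xs

      State : Set
      State = Fin r × Bool × Fin q

      step : State → Bool → State
      step (c , f , k) b =
        suc (toℕ c) mod r , flag (toℕ c) f b , (bit (does (toℕ c ≟ W) ∧ flag (toℕ c) f b) + toℕ k) mod q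

      count : State → ℕ
      count (c , f , k) = toℕ k

      count-fires : ∀ c f k xs → count (foldl step (c , f , k) xs) ≡ (fires (toℕ c) f xs + toℕ k) % q
      count-fires c f k []       = sym (m<n⇒m%n≡m (toℕ<n k))
      count-fires c f k (b ∷ xs) = begin
        count (foldl step (step (c , f , k) b) xs)      ≡⟨ count-fires _ f′ _ xs ⟩
        (fires (toℕ c′) f′ xs + toℕ ((p + toℕ k) mod q)) % q
          ≡⟨ cong₂ (λ i j → (fires i f′ xs + j) % q) (toℕ-fromℕ< (m%n<n (suc (toℕ c)) r)) (toℕ-fromℕ< (m%n<n (p + toℕ k) q)) ⟩
        (F + (p + toℕ k) % q) % q                       ≡⟨ %-+ʳ F (p + toℕ k) q ⟩
        (F + (p + toℕ k)) % q                           ≡⟨ cong (_% q) (trans (sym (+-assoc F p (toℕ k))) (cong (_+ toℕ k) (+-comm F p))) ⟩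
        (p + F + toℕ k) % q                             ∎
        where
        open ≡-Reasoning
        c′ = suc (toℕ c) mod r
        f′ = flag (toℕ c) f b
        p = bit (does (toℕ c ≟ W) ∧ f′)
        F = fires (suc (toℕ c) % r) f′ xs

      module _ (1≤W : 1 ≤ W) (W<r : W < r) where

        occ : List Bool → ℕ → ℕ
        occ xs s = bit (occurs xs s)

        next-idle : ∀ c → W ≤ c → c < r → suc c % r ≡ 0 ⊎ W < suc c % r
        next-idle c W≤c c<r with suc c ≟ r
        ... | yes refl = inj₁ (n%n≡0 (suc c))
        ... | no  c≢   = inj₂ (subst (W <_) (sym (m<n⇒m%n≡m (≤∧≢⇒< c<r c≢))) (s≤s W≤c))

        -- Holds for every `f`, junk included: at phase 0 `flag` overrides the old bit, and beyond
        -- phase `W` nothing fires until the phase has wrapped round to 0.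
        fires-idle : ∀ c f xs → c < r → c ≡ 0 ⊎ W < c →
                     fires c f xs ≡ residueSum r c (length xs) (occ xs)
        -- The open window began before the current suffix, so `residueSum` does not see it; its
        -- possible completion is the extra bit. As `W < r`, it closes before the next window opens,
        -- which is why one bit of memory suffices.
        fires-pending : ∀ c l f xs → suc c + l ≡ W →
                     fires (suc c) f xs ≡ bit (f ∧ matches (suc c) (suc l) xs) + residueSum r (suc c) (length xs) (occ xs)

        below : ∀ c l → c + suc l ≡ W → c < W
        below c l eq = subst (c <_) eq (m<m+n c (s≤s z≤n))

        fires-idle c f [] _ _ = refl
        fires-idle _ f (b ∷ xs) _ (inj₁ refl)
          rewrite dec-false (0 ≟ W) (<⇒≢ 1≤W) | Bool.∨-zeroʳ f | m<n⇒m%n≡m (≤-<-trans 1≤W W<r)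
          = trans (fires-pending 0 (pred W) (b == w 0) xs W≡)
                  (cong (λ l → bit ((b == w 0) ∧ matches 1 l xs) + residueSum r 1 (length xs) (occ xs)) W≡)
          where W≡ = suc-pred W {{>-nonZero 1≤W}}
        fires-idle (suc c) f (b ∷ xs) c<r (inj₂ W<c)
          rewrite dec-false (suc c ≟ W) (≢-sym (<⇒≢ W<c))
          = fires-idle (suc (suc c) % r) _ xs (m%n<n (suc (suc c)) r) (next-idle (suc c) (<⇒≤ W<c) c<r)

        fires-pending c l f [] _ rewrite Bool.∧-zeroʳ f = refl
        fires-pending c zero f (b ∷ xs) c≡W
          rewrite dec-true (suc c ≟ W) (trans (sym (+-identityʳ (suc c))) c≡W) | Bool.∨-identityʳ f
                | Bool.∧-identityʳ (b == w (suc c))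
          = cong (bit (f ∧ (b == w (suc c))) +_)
              (fires-idle (suc (suc c) % r) _ xs (m%n<n (suc (suc c)) r)
                (next-idle (suc c) (≤-reflexive (sym c≡W′)) (≤-<-trans (≤-reflexive c≡W′) W<r)))
          where c≡W′ = trans (sym (+-identityʳ (suc c))) c≡W
        fires-pending c (suc l) f (b ∷ xs) c≡W
          rewrite dec-false (suc c ≟ W) (<⇒≢ (below (suc c) l c≡W)) | Bool.∨-identityʳ f
                | m<n⇒m%n≡m (≤-<-trans (below (suc c) l c≡W) W<r)
          = trans (fires-pending (suc c) l _ xs (trans (sym (+-suc (suc c) l)) c≡W))
                  (cong (λ m → bit m + residueSum r (suc (suc c)) (length xs) (occ xs)) (Bool.∧-assoc f _ _))

-- Weighted sums modulo r, and Chebyshev polynomials over the integers.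

module ChebyshevWeights where

  open import Data.Nat as ℕ using (ℕ; zero; suc)
  import Data.Nat.Properties as ℕ
  open import Data.Nat.DivMod using (_%_; m<n⇒m%n≡m; n%n≡0)
  open import Data.Integer hiding (suc; _%_)
  open import Data.Integer.Properties
  open import Data.Integer.Divisibility.Signed
  open import Data.Integer.Tactic.RingSolver using (solve-∀)
  open import Data.Product using (_×_; _,_)
  open import Function using (_∘_)
  open import Relation.Binary.PropositionalEquality
  open PatternCounting using (residueSum)


  Σ< : ℕ → (ℕ → ℤ) → ℤ
  Σ< zero    f = 0ℤ
  Σ< (suc n) f = f 0 + Σ< n (f ∘ suc)

  Σ<-cong : ∀ n {f g} → (∀ i → i ℕ.< n → f i ≡ g i) → Σ< n f ≡ Σ< n g
  Σ<-cong zero    eq = refl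
  Σ<-cong (suc n) eq = cong₂ _+_ (eq 0 ℕ.z<s) (Σ<-cong n λ i i<n → eq (suc i) (ℕ.s<s i<n))

  Σ<-zero : ∀ n {f} → (∀ i → i ℕ.< n → f i ≡ 0ℤ) → Σ< n f ≡ 0ℤ
  Σ<-zero zero    eq = refl
  Σ<-zero (suc n) eq = cong₂ _+_ (eq 0 ℕ.z<s) (Σ<-zero n λ i i<n → eq (suc i) (ℕ.s<s i<n))

  Σ<-last : ∀ n f → Σ< (suc n) f ≡ Σ< n f + f n
  Σ<-last zero    f = +-comm (f 0) 0ℤ
  Σ<-last (suc n) f = trans (cong (_+_ (f 0)) (Σ<-last n (f ∘ suc))) (sym (+-assoc (f 0) _ _))

  Σ<-minus : ∀ n f g → Σ< n f - Σ< n g ≡ Σ< n (λ i → f i - g i)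
  Σ<-minus zero    f g = refl
  Σ<-minus (suc n) f g = trans (l (f 0) _ (g 0) _) (cong (_+_ (f 0 - g 0)) (Σ<-minus n (f ∘ suc) (g ∘ suc)))
    where
    l : ∀ a b c d → (a + b) - (c + d) ≡ (a - c) + (b - d)
    l = solve-∀

  Σ<-split : ∀ m n f → Σ< (m ℕ.+ n) f ≡ Σ< m f + Σ< n (λ i → f (m ℕ.+ i))
  Σ<-split zero    n f = sym (+-identityˡ _)
  Σ<-split (suc m) n f = trans (cong (_+_ (f 0)) (Σ<-split m n (f ∘ suc))) (sym (+-assoc (f 0) _ _))

  -- The residue sums determine Σ α(s) h(t + s) modulo r.
  residueSums-combine : ∀ r .{{_ : ℕ.NonZero r}} (h : ℤ → ℤ) → (∀ a → + r ∣ h a - h (a + + r)) → ∀ n α t →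
    + r ∣ Σ< r (λ c → h (t - + c) * + residueSum r c n α) - Σ< n (λ s → + α s * h (t + + s))
  residueSums-combine r@(suc r′) h periodic zero α t =
    subst (λ z → + r ∣ z - 0ℤ) (sym (Σ<-zero r λ c _ → *-zeroʳ (h (t - + c)))) (divides 0ℤ refl)
  residueSums-combine r@(suc r′) h periodic (suc n) α t =
    subst (+ r ∣_) (sym difference) (∣m∣n⇒∣m+n (∣m⇒∣m*n (G 0) wrap) (residueSums-combine r h periodic n (α ∘ suc) (t + 1ℤ)))
    where
    open ≡-Reasoning
    G : ℕ → ℤ
    G c = + residueSum r c n (α ∘ suc)
    M B : ℤ
    M = Σ< r′ (λ c → h (t - + c) * G (suc c))
    B = Σ< n (λ s → + α (suc s) * h (t + + suc s))

    -- Dropping position 0 moves class c to c + 1 with the same argument of `h`. Only class r - 1,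
    -- which becomes class 0, has its argument changed, and by exactly `r`.
    wrap : + r ∣ h (t - + r′) - h (t + 1ℤ)
    wrap = subst (λ z → + r ∣ h (t - + r′) - h z) (l t (+ r′)) (periodic (t - + r′))
      where
      l : ∀ t r → t - r + (1ℤ + r) ≡ t + 1ℤ
      l = solve-∀

    rotate : ∀ c → c ℕ.< r′ → h (t - + c) * + residueSum r (suc c % r) n (α ∘ suc) ≡ h (t - + c) * G (suc c)
    rotate c c<r′ = cong (λ i → h (t - + c) * G i) (m<n⇒m%n≡m (ℕ.s<s c<r′))

    lhs : Σ< r (λ c → h (t - + c) * + residueSum r c (suc n) α) ≡ + α 0 * h (t + 0ℤ) + (M + h (t - + r′) * G 0)
    lhs = begin
      h (t - 0ℤ) * + (α 0 ℕ.+ residueSum r (1 % r) n (α ∘ suc)) + Σ< r′ (λ c → h (t - + suc c) * + residueSum r (suc (suc c) % r) n (α ∘ suc))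
        ≡⟨ cong (_+ Σ< r′ (λ c → h (t - + suc c) * G (suc (suc c) % r))) (cong₂ _*_ (cong h (+-identityʳ t)) (pos-+ (α 0) _)) ⟩
      h t * (+ α 0 + G (1 % r)) + Σ< r′ (λ c → h (t - + suc c) * G (suc (suc c) % r))
        ≡⟨ l (h t) (+ α 0) (G (1 % r)) _ ⟩
      + α 0 * h t + (h t * G (1 % r) + Σ< r′ (λ c → h (t - + suc c) * G (suc (suc c) % r)))
        ≡⟨ cong₂ (λ x y → + α 0 * h x + (h y * G (1 % r) + Σ< r′ (λ c → h (t - + suc c) * G (suc (suc c) % r)))) (+-identityʳ t) (+-identityʳ t) ⟨
      + α 0 * h (t + 0ℤ) + Σ< r (λ c → h (t - + c) * G (suc c % r))
        ≡⟨ cong (_+_ (+ α 0 * h (t + 0ℤ))) (Σ<-last r′ (λ c → h (t - + c) * G (suc c % r))) ⟩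
      + α 0 * h (t + 0ℤ) + (Σ< r′ (λ c → h (t - + c) * G (suc c % r)) + h (t - + r′) * G (r % r))
        ≡⟨ cong₂ (λ x y → + α 0 * h (t + 0ℤ) + (x + h (t - + r′) * G y)) (Σ<-cong r′ rotate) (n%n≡0 r) ⟩
      + α 0 * h (t + 0ℤ) + (M + h (t - + r′) * G 0) ∎
      where
      l : ∀ a b c d → a * (b + c) + d ≡ b * a + (a * c + d)
      l = solve-∀

    ih-lhs : Σ< r (λ c → h (t + 1ℤ - + c) * G c) ≡ h (t + 1ℤ) * G 0 + M
    ih-lhs = cong₂ _+_ (cong (λ i → h i * G 0) (+-identityʳ (t + 1ℤ)))
               (Σ<-cong r′ λ c _ → cong (λ i → h i * G (suc c)) (l t (+ c)))
      where
      l : ∀ t c → t + 1ℤ - (1ℤ + c) ≡ t - c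
      l = solve-∀

    ih-rhs : Σ< n (λ s → + α (suc s) * h (t + 1ℤ + + s)) ≡ B
    ih-rhs = Σ<-cong n λ s _ → cong (λ i → + α (suc s) * h i) (+-assoc t 1ℤ (+ s))

    difference :
      Σ< r (λ c → h (t - + c) * + residueSum r c (suc n) α) - (+ α 0 * h (t + 0ℤ) + B) ≡
      (h (t - + r′) - h (t + 1ℤ)) * G 0 +
        (Σ< r (λ c → h (t + 1ℤ - + c) * G c) - Σ< n (λ s → + α (suc s) * h (t + 1ℤ + + s)))
    difference = trans (cong (_- (+ α 0 * h (t + 0ℤ) + B)) lhs)
      (trans (l (+ α 0 * h (t + 0ℤ)) M (h (t - + r′)) (h (t + 1ℤ)) (G 0) B)
        (cong₂ (λ x y → (h (t - + r′) - h (t + 1ℤ)) * G 0 + (x - y)) (sym ih-lhs) (sym ih-rhs)))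
      where
      l : ∀ a m x y g b → (a + (m + x * g)) - (a + b) ≡ (x - y) * g + ((y * g + m) - b)
      l = solve-∀

  -- T (2 ^ i) (u / v) · v ^ (2 ^ i) for the Chebyshev polynomials T, by
  -- iterating T₂ x = 2x² - 1.
  cheb : ℕ → ℤ → ℤ → ℤ
  cheb zero    u v = u
  cheb (suc i) u v = cheb i (+ 2 * (u * u) - v * v) (v * v)

  -- x ^ (2 ^ i)
  tower : ℕ → ℤ → ℤ
  tower zero    x = x
  tower (suc i) x = tower i (x * x)

  cheb-cong : ∀ {r} i u u′ v → r ∣ u - u′ → r ∣ cheb i u v - cheb i u′ v
  cheb-cong zero    u u′ v d = d
  cheb-cong {r} (suc i) u u′ v d = cheb-cong i _ _ _
    (subst (r ∣_) (l u u′ v) (∣m⇒∣m*n (+ 2 * (u + u′)) d))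
    where
    l : ∀ u u′ v → (u - u′) * (+ 2 * (u + u′)) ≡ (+ 2 * (u * u) - v * v) - (+ 2 * (u′ * u′) - v * v)
    l = solve-∀

  *-nonNeg : ∀ {a b} → 0ℤ ≤ a → 0ℤ ≤ b → 0ℤ ≤ a * b
  *-nonNeg {a} {b} 0≤a 0≤b = subst (_≤ a * b) (*-zeroʳ a) (*-monoˡ-≤-nonNeg a {{nonNegative 0≤a}} 0≤b)

  +-nonNeg : ∀ {a b} → 0ℤ ≤ a → 0ℤ ≤ b → 0ℤ ≤ a + b
  +-nonNeg = +-mono-≤

  square-nonNeg : ∀ a → 0ℤ ≤ a * a
  square-nonNeg (+ n)      = *-nonNeg {+ n} (+≤+ ℕ.z≤n) (+≤+ ℕ.z≤n)
  square-nonNeg -[1+ n ]   = +≤+ ℕ.z≤n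

  0≤+ : ∀ {n} → 0ℤ ≤ + n
  0≤+ = +≤+ ℕ.z≤n

  -- Reduces polynomial inequalities to ring identities: `c` is a certificate built from visibly
  -- nonnegative products and squares, and the solver checks that it equals the difference.
  ≤-by : ∀ {a b} c → 0ℤ ≤ c → b - a ≡ c → a ≤ b
  ≤-by c 0≤c eq = 0≤i-j⇒j≤i (subst (0ℤ ≤_) (sym eq) 0≤c)

  tower-nonNeg : ∀ i {x} → 0ℤ ≤ x → 0ℤ ≤ tower i x
  tower-nonNeg zero    0≤x = 0≤x
  tower-nonNeg (suc i) {x} 0≤x = tower-nonNeg i (square-nonNeg x)

  tower-2^ : ∀ i a → tower i (+ (2 ℕ.^ a)) ≡ + (2 ℕ.^ (a ℕ.* 2 ℕ.^ i))
  tower-2^ zero    a = cong (λ x → + (2 ℕ.^ x)) (sym (ℕ.*-identityʳ a))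
  tower-2^ (suc i) a = begin
    tower i (+ (2 ℕ.^ a) * + (2 ℕ.^ a))   ≡⟨ cong (tower i) (pos-* (2 ℕ.^ a) (2 ℕ.^ a)) ⟨
    tower i (+ (2 ℕ.^ a ℕ.* 2 ℕ.^ a))     ≡⟨ cong (λ x → tower i (+ x)) (ℕ.^-distribˡ-+-* 2 a a) ⟨
    tower i (+ (2 ℕ.^ (a ℕ.+ a)))         ≡⟨ tower-2^ i (a ℕ.+ a) ⟩
    + (2 ℕ.^ ((a ℕ.+ a) ℕ.* 2 ℕ.^ i))     ≡⟨ cong (λ x → + (2 ℕ.^ x)) (l a (2 ℕ.^ i)) ⟩
    + (2 ℕ.^ (a ℕ.* (2 ℕ.* 2 ℕ.^ i)))     ∎
    where
    open ≡-Reasoning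
    open import Data.Nat.Tactic.RingSolver renaming (solve-∀ to solveℕ)
    l : ∀ a x → (a ℕ.+ a) ℕ.* x ≡ a ℕ.* (2 ℕ.* x)
    l = solveℕ

  -- T₂ maps [-1, 1] into itself, hence so do its iterates.
  cheb-inside : ∀ i {u v} → 0ℤ ≤ v → - v ≤ u → u ≤ v → - tower i v ≤ cheb i u v × cheb i u v ≤ tower i v
  cheb-inside zero    0≤v -v≤u u≤v = -v≤u , u≤v
  cheb-inside (suc i) {u} {v} 0≤v -v≤u u≤v = cheb-inside i (square-nonNeg v)
    (≤-by (+ 2 * (u * u)) (*-nonNeg {+ 2} 0≤+ (square-nonNeg u)) (l₁ u v))
    (≤-by (+ 2 * ((v - u) * (u - - v)))
      (*-nonNeg {+ 2} 0≤+ (*-nonNeg (i≤j⇒0≤j-i u≤v) (i≤j⇒0≤j-i -v≤u))) (l₂ u v))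
    where
    l₁ : ∀ u v → (+ 2 * (u * u) - v * v) - - (v * v) ≡ + 2 * (u * u)
    l₁ = solve-∀
    l₂ : ∀ u v → (v * v) - (+ 2 * (u * u) - v * v) ≡ + 2 * ((v - u) * (u - - v))
    l₂ = solve-∀

  -- One step replaces the bound b by 2b², and 2 · 2b² = (2b)². So it is the bound on twice the
  -- value that is squared at each step, as `tower` is.
  cheb-crude : ∀ i {u v b} → 0ℤ ≤ v → v ≤ b → - b ≤ u → u ≤ b →
               - tower i (+ 2 * b) ≤ + 2 * cheb i u v × + 2 * cheb i u v ≤ tower i (+ 2 * b)
  cheb-crude zero {u} {v} {b} 0≤v v≤b -b≤u u≤b =
    subst (_≤ + 2 * u) (l b) (*-monoˡ-≤-nonNeg (+ 2) -b≤u) , *-monoˡ-≤-nonNeg (+ 2) u≤b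
    where
    l : ∀ b → + 2 * - b ≡ - (+ 2 * b)
    l = solve-∀
  cheb-crude (suc i) {u} {v} {b} 0≤v v≤b -b≤u u≤b =
    subst (λ x → - tower i x ≤ + 2 * cheb (suc i) u v × + 2 * cheb (suc i) u v ≤ tower i x) (l b)
      (cheb-crude i {b = + 2 * (b * b)} (square-nonNeg v)
        (≤-by (b * b + (b - v) * (b + v)) (+-nonNeg (square-nonNeg b) b²≥v²) (l₀ b v))
        (≤-by (b * b + (b - v) * (b + v) + + 2 * (u * u))
          (+-nonNeg (+-nonNeg (square-nonNeg b) b²≥v²) (*-nonNeg {+ 2} 0≤+ (square-nonNeg u))) (l₁ u v b))
        (≤-by (+ 2 * ((b - u) * (u - - b)) + v * v)
          (+-nonNeg (*-nonNeg {+ 2} 0≤+ (*-nonNeg (i≤j⇒0≤j-i u≤b) (i≤j⇒0≤j-i -b≤u))) (square-nonNeg v)) (l₂ u v b)))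
    where
    b²≥v² : 0ℤ ≤ (b - v) * (b + v)
    b²≥v² = *-nonNeg (i≤j⇒0≤j-i v≤b) (+-nonNeg (≤-trans 0≤v v≤b) 0≤v)
    l : ∀ b → + 2 * (+ 2 * (b * b)) ≡ (+ 2 * b) * (+ 2 * b)
    l = solve-∀
    l₀ : ∀ b v → + 2 * (b * b) - v * v ≡ b * b + (b - v) * (b + v)
    l₀ = solve-∀
    l₁ : ∀ u v b → (+ 2 * (u * u) - v * v) - - (+ 2 * (b * b)) ≡ b * b + (b - v) * (b + v) + + 2 * (u * u)
    l₁ = solve-∀
    l₂ : ∀ u v b → + 2 * (b * b) - (+ 2 * (u * u) - v * v) ≡ + 2 * ((b - u) * (u - - b)) + v * v
    l₂ = solve-∀

  module _ {u v : ℤ} (0≤v : 0ℤ ≤ v) (v≤u : v ≤ u) where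
    T₂-outside : v * v ≤ + 2 * (u * u) - v * v
    T₂-outside = ≤-by (+ 2 * ((u - v) * (u + v)))
      (*-nonNeg {+ 2} 0≤+ (*-nonNeg (i≤j⇒0≤j-i v≤u) (+-nonNeg (≤-trans 0≤v v≤u) 0≤v))) (l u v)
      where
      l : ∀ u v → (+ 2 * (u * u) - v * v) - (v * v) ≡ + 2 * ((u - v) * (u + v))
      l = solve-∀

  -- T₂ x′ - T₂ x = 2 (x′ - x)(x′ + x), so T₂ is increasing on [1, ∞), which it maps into itself.
  cheb-mono : ∀ i {u u′ v} → 0ℤ ≤ v → v ≤ u → u ≤ u′ → tower i v ≤ cheb i u v × cheb i u v ≤ cheb i u′ v
  cheb-mono zero    0≤v v≤u u≤u′ = v≤u , u≤u′
  cheb-mono (suc i) {u} {u′} {v} 0≤v v≤u u≤u′ = cheb-mono i (square-nonNeg v) (T₂-outside 0≤v v≤u)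
    (≤-by (+ 2 * ((u′ - u) * (u′ + u)))
      (*-nonNeg {+ 2} 0≤+ (*-nonNeg (i≤j⇒0≤j-i u≤u′) (+-nonNeg (≤-trans 0≤u u≤u′) 0≤u))) (l u u′ v))
    where
    0≤u = ≤-trans 0≤v v≤u
    l : ∀ u u′ v → (+ 2 * (u′ * u′) - v * v) - (+ 2 * (u * u) - v * v) ≡ + 2 * ((u′ - u) * (u′ + u))
    l = solve-∀

  -- Write x = u / v ≥ A and x′ = u′ / v. By T₂ x - T₂ x′ = 2 (x - x′)(x + x′), one step multiplies
  -- the difference by at least 2A, while the lower bound on x rises from A to A². So the hypotheses
  -- recur with A² for `A`, and the factor `J` is unchanged.
  cheb-gap-large : ∀ i {A J u u′ v} → 0ℤ ≤ A → 0ℤ ≤ v → 0ℤ ≤ J → v ≤ u → v ≤ u′ → u′ ≤ u → A * v ≤ u → A * v ≤ J * (u - u′) →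
               tower i A * tower i v ≤ J * (cheb i u v - cheb i u′ v)
  cheb-gap-large zero _ _ _ _ _ _ _ gap = gap
  cheb-gap-large (suc i) {A} {J} {u} {u′} {v} 0≤A 0≤v 0≤J v≤u v≤u′ u′≤u Av≤u gap =
    cheb-gap-large i (square-nonNeg A) (square-nonNeg v) 0≤J (T₂-outside 0≤v v≤u) (T₂-outside 0≤v v≤u′)
      (≤-by (+ 2 * ((u - u′) * (u + u′))) (*-nonNeg {+ 2} 0≤+ (*-nonNeg (i≤j⇒0≤j-i u′≤u) (+-nonNeg 0≤u 0≤u′))) (l₀ u u′ v))
      (≤-by ((u * u - A * v * (A * v)) + (u - v) * (u + v))
        (+-nonNeg u²≥ (*-nonNeg (i≤j⇒0≤j-i v≤u) (+-nonNeg 0≤u 0≤v))) (l₁ A u v))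
      (≤-by (+ 2 * ((J * (u - u′) - A * v) * (u + u′)) + + 2 * (A * v * (u + u′ - A * v)) + A * v * (A * v))
        (+-nonNeg (+-nonNeg
          (*-nonNeg {+ 2} 0≤+ (*-nonNeg (i≤j⇒0≤j-i gap) (+-nonNeg 0≤u 0≤u′)))
          (*-nonNeg {+ 2} 0≤+ (*-nonNeg 0≤Av (subst (0ℤ ≤_) (l₃ u u′ (A * v)) (+-nonNeg (i≤j⇒0≤j-i Av≤u) 0≤u′)))))
          (square-nonNeg (A * v))) (l₂ A J u u′ v))
    where
    0≤u = ≤-trans 0≤v v≤u
    0≤u′ = ≤-trans 0≤v v≤u′
    0≤Av = *-nonNeg 0≤A 0≤v
    u²≥ : 0ℤ ≤ u * u - A * v * (A * v)
    u²≥ = subst (0ℤ ≤_) (l u (A * v)) (*-nonNeg (i≤j⇒0≤j-i Av≤u) (+-nonNeg 0≤u 0≤Av))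
      where
      l : ∀ u w → (u - w) * (u + w) ≡ u * u - w * w
      l = solve-∀
    l₀ : ∀ u u′ v → (+ 2 * (u * u) - v * v) - (+ 2 * (u′ * u′) - v * v) ≡ + 2 * ((u - u′) * (u + u′))
    l₀ = solve-∀
    l₁ : ∀ A u v → (+ 2 * (u * u) - v * v) - (A * A) * (v * v) ≡ (u * u - A * v * (A * v)) + (u - v) * (u + v)
    l₁ = solve-∀
    l₂ : ∀ A J u u′ v → J * ((+ 2 * (u * u) - v * v) - (+ 2 * (u′ * u′) - v * v)) - (A * A) * (v * v) ≡
         + 2 * ((J * (u - u′) - A * v) * (u + u′)) + + 2 * (A * v * (u + u′ - A * v)) + A * v * (A * v)
    l₂ = solve-∀
    l₃ : ∀ u u′ w → (u - w) + u′ ≡ u + u′ - w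
    l₃ = solve-∀

  -- The first k steps multiply u / v - 1 by at least 4 each, which brings
  -- u / v up to 2; from then on every step squares it.
  cheb-gap : ∀ k i {J u u′ v} → 0ℤ ≤ v → 0ℤ ≤ J → v ≤ u′ → u′ ≤ u → v ≤ + (4 ℕ.^ k) * (u - v) → + 2 * v ≤ J * (u - u′) →
             tower i (+ 2) * tower (k ℕ.+ i) v ≤ J * (cheb (k ℕ.+ i) u v - cheb (k ℕ.+ i) u′ v)
  cheb-gap zero i {J} {u} {u′} {v} 0≤v 0≤J v≤u′ u′≤u far gap =
    cheb-gap-large i {+ 2} 0≤+ 0≤v 0≤J (≤-trans v≤u′ u′≤u) v≤u′ u′≤u
      (≤-by (+ 1 * (u - v) - v) (i≤j⇒0≤j-i far) (l u v)) gap
    where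
    l : ∀ u v → u - + 2 * v ≡ + 1 * (u - v) - v
    l = solve-∀
  cheb-gap (suc k) i {J} {u} {u′} {v} 0≤v 0≤J v≤u′ u′≤u far gap =
    cheb-gap k i (square-nonNeg v) 0≤J (T₂-outside 0≤v v≤u′)
      (≤-by (+ 2 * ((u - u′) * (u + u′))) (*-nonNeg {+ 2} 0≤+ (*-nonNeg (i≤j⇒0≤j-i u′≤u) (+-nonNeg 0≤u 0≤u′))) (l₀ u u′ v))
      (≤-by (v * (+ 4 * K * (u - v) - v) + + 2 * (K * ((u - v) * (u - v))))
        (+-nonNeg (*-nonNeg 0≤v (i≤j⇒0≤j-i (subst (λ x → v ≤ x * (u - v)) (pos-* 4 (4 ℕ.^ k)) far)))
          (*-nonNeg {+ 2} 0≤+ (*-nonNeg {K} 0≤+ (square-nonNeg (u - v))))) (l₁ K u v))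
      (≤-by (+ 2 * ((J * (u - u′)) * ((u - v) + (u′ - v))) + + 4 * (v * (J * (u - u′) - + 2 * v)) + + 6 * (v * v))
        (+-nonNeg (+-nonNeg
          (*-nonNeg {+ 2} 0≤+ (*-nonNeg (*-nonNeg 0≤J (i≤j⇒0≤j-i u′≤u)) (+-nonNeg (i≤j⇒0≤j-i v≤u) (i≤j⇒0≤j-i v≤u′))))
          (*-nonNeg {+ 4} 0≤+ (*-nonNeg 0≤v (i≤j⇒0≤j-i gap))))
          (*-nonNeg {+ 6} 0≤+ (square-nonNeg v))) (l₂ J u u′ v))
    where
    K = + (4 ℕ.^ k)
    v≤u = ≤-trans v≤u′ u′≤u
    0≤u = ≤-trans 0≤v v≤u
    0≤u′ = ≤-trans 0≤v v≤u′
    l₀ : ∀ u u′ v → (+ 2 * (u * u) - v * v) - (+ 2 * (u′ * u′) - v * v) ≡ + 2 * ((u - u′) * (u + u′))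
    l₀ = solve-∀
    l₁ : ∀ K u v → K * ((+ 2 * (u * u) - v * v) - v * v) - v * v ≡ v * (+ 4 * K * (u - v) - v) + + 2 * (K * ((u - v) * (u - v)))
    l₁ = solve-∀
    l₂ : ∀ J u u′ v → J * ((+ 2 * (u * u) - v * v) - (+ 2 * (u′ * u′) - v * v)) - + 2 * (v * v) ≡
         + 2 * ((J * (u - u′)) * ((u - v) + (u′ - v))) + + 4 * (v * (J * (u - u′) - + 2 * v)) + + 6 * (v * v)
    l₂ = solve-∀

-- Weighted differences of two separated sets do not vanish.

module SeparatedSets where

  open import Data.Bool using (Bool; true; false)
  open import Data.Bool.Properties using (¬-not)
  open import Data.Empty using (⊥)
  open import Data.Nat as ℕ using (ℕ; zero; suc)
  import Data.Nat.Properties as ℕ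
  open import Data.Integer hiding (suc; _%_)
  open import Data.Integer.Properties
  open import Data.Integer.Divisibility.Signed
  open import Data.Integer.Tactic.RingSolver using (solve-∀)
  open import Data.Product using (_×_; _,_; proj₁; proj₂)
  open import Data.Sum using (inj₁; inj₂; _⊎_)
  open import Function using (_∘_)
  open import Relation.Binary.PropositionalEquality
  open import Relation.Nullary
  open PatternCounting using (bit)
  open ChebyshevWeights


  Separated : ℕ → (ℕ → Bool) → Set
  Separated L α = ∀ s p → 1 ℕ.≤ p → p ℕ.≤ L → α s ≡ true → α (s ℕ.+ p) ≡ true → ⊥

  Σ<-≥ : ∀ n g V → (∀ j → j ℕ.< n → - V ≤ g j) → - (+ n * V) ≤ Σ< n g
  Σ<-≥ zero    g V low = ≤-refl
  Σ<-≥ (suc n) g V low = subst (_≤ Σ< (suc n) g) (l (+ n) V) (+-mono-≤ (low 0 ℕ.z<s) (Σ<-≥ n (g ∘ suc) V λ j j<n → low (suc j) (ℕ.s<s j<n)))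
    where
    l : ∀ n V → - V + - (n * V) ≡ - ((1ℤ + n) * V)
    l = solve-∀

  -- "At most one term below -V" is phrased through what follows an exceptional index, so that the
  -- induction ends at the first exception and hands the rest to `Σ<-≥`.
  Σ<-≥-except : ∀ n g H V → 0ℤ ≤ H → 0ℤ ≤ V →
    (∀ j → j ℕ.< n → - V ≤ g j ⊎ (- H ≤ g j × (∀ j′ → j ℕ.< j′ → j′ ℕ.< n → - V ≤ g j′))) →
    - (H + + n * V) ≤ Σ< n g
  Σ<-≥-except zero    g H V 0≤H 0≤V low = ≤-by H 0≤H (l H V)
    where
    l : ∀ H V → 0ℤ - - (H + 0ℤ * V) ≡ H
    l = solve-∀
  Σ<-≥-except (suc n) g H V 0≤H 0≤V low with low 0 ℕ.z<s
  ... | inj₁ low₀ = subst (_≤ Σ< (suc n) g) (l H (+ n) V) (+-mono-≤ low₀ (Σ<-≥-except n (g ∘ suc) H V 0≤H 0≤V rest))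
    where
    l : ∀ H n V → - V + - (H + n * V) ≡ - (H + (1ℤ + n) * V)
    l = solve-∀
    rest : ∀ j → j ℕ.< n → - V ≤ g (suc j) ⊎ (- H ≤ g (suc j) × (∀ j′ → j ℕ.< j′ → j′ ℕ.< n → - V ≤ g (suc j′)))
    rest j j<n with low (suc j) (ℕ.s<s j<n)
    ... | inj₁ p       = inj₁ p
    ... | inj₂ (p , q) = inj₂ (p , λ j′ j<j′ j′<n → q (suc j′) (ℕ.s<s j<j′) (ℕ.s<s j′<n))
  ... | inj₂ (low₀ , rest) = ≤-trans
    (≤-by V 0≤V (l H (+ n) V))
    (+-mono-≤ low₀ (Σ<-≥ n (g ∘ suc) V λ j j<n → rest (suc j) ℕ.z<s (ℕ.s<s j<n)))
    where
    l : ∀ H n V → (- H + - (n * V)) - - (H + (1ℤ + n) * V) ≡ V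
    l = solve-∀

  ∣Σ<∣≤ : ∀ n g B → (∀ j → j ℕ.< n → ∣ g j ∣ ℕ.≤ B) → ∣ Σ< n g ∣ ℕ.≤ n ℕ.* B
  ∣Σ<∣≤ zero    g B bound = ℕ.z≤n
  ∣Σ<∣≤ (suc n) g B bound = ℕ.≤-trans (∣i+j∣≤∣i∣+∣j∣ (g 0) _)
    (ℕ.+-mono-≤ (bound 0 ℕ.z<s) (∣Σ<∣≤ n (g ∘ suc) B λ j j<n → bound (suc j) (ℕ.s<s j<n)))

  bits-difference : (b c : Bool) → ℤ → ℤ
  bits-difference b c x = + bit b * x - + bit c * x

  difference-tt : ∀ x → bits-difference true true x ≡ 0ℤ
  difference-tt = l
    where
    l : ∀ x → + 1 * x - + 1 * x ≡ 0ℤ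
    l = solve-∀

  difference-ff : ∀ x → bits-difference false false x ≡ 0ℤ
  difference-ff = l
    where
    l : ∀ x → + 0 * x - + 0 * x ≡ 0ℤ
    l = solve-∀

  difference-tf : ∀ x → bits-difference true false x ≡ x
  difference-tf = l
    where
    l : ∀ x → + 1 * x - + 0 * x ≡ x
    l = solve-∀

  difference-ft : ∀ x → bits-difference false true x ≡ - x
  difference-ft = l
    where
    l : ∀ x → + 0 * x - + 1 * x ≡ - x
    l = solve-∀


  difference-≥ : ∀ b c {x V} → 0ℤ ≤ V → - V ≤ x → x ≤ V → - V ≤ bits-difference b c x
  difference-≥ true  true  {x} {V} 0≤V low up = subst (- V ≤_) (sym (difference-tt x)) (neg-mono-≤ 0≤V)
  difference-≥ false false {x} {V} 0≤V low up = subst (- V ≤_) (sym (difference-ff x)) (neg-mono-≤ 0≤V)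
  difference-≥ true  false {x} {V} 0≤V low up = subst (- V ≤_) (sym (difference-tf x)) low
  difference-≥ false true  {x} {V} 0≤V low up = subst (- V ≤_) (sym (difference-ft x)) (neg-mono-≤ up)

  ∣difference∣≤ : ∀ b c x → ∣ bits-difference b c x ∣ ℕ.≤ ∣ x ∣
  ∣difference∣≤ true  true  x = subst (ℕ._≤ ∣ x ∣) (cong ∣_∣ (sym (difference-tt x))) ℕ.z≤n
  ∣difference∣≤ false false x = subst (ℕ._≤ ∣ x ∣) (cong ∣_∣ (sym (difference-ff x))) ℕ.z≤n
  ∣difference∣≤ true  false x = ℕ.≤-reflexive (cong ∣_∣ (difference-tf x))
  ∣difference∣≤ false true  x = ℕ.≤-reflexive (trans (cong ∣_∣ (difference-ft x)) (∣-i∣≡∣i∣ x))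

  difference-neg : ∀ b c x → bits-difference b c x ≡ - bits-difference c b x
  difference-neg b c x = l (+ bit b) (+ bit c) x
    where
    l : ∀ b c x → b * x - c * x ≡ - (c * x - b * x)
    l = solve-∀

  Σ<-neg : ∀ n f → Σ< n (λ s → - f s) ≡ - Σ< n f
  Σ<-neg zero    f = refl
  Σ<-neg (suc n) f = trans (cong (_+_ (- f 0)) (Σ<-neg n (f ∘ suc))) (sym (neg-distrib-+ (f 0) _))

  module _ {t L N : ℕ} (h : ℕ → ℤ) {H V : ℤ} (0≤V : 0ℤ ≤ V) (0≤H : 0ℤ ≤ H)
           (near : ∀ j → 1 ℕ.≤ j → j ℕ.≤ L → 0ℤ ≤ h (t ℕ.+ j) × h (t ℕ.+ j) ≤ H)
           (far : ∀ j → L ℕ.< j → j ℕ.≤ N → - V ≤ h (t ℕ.+ j) × h (t ℕ.+ j) ≤ V)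
           (big : H + + N * V < h t) where

    -- Before `t` all terms cancel, and `t` itself contributes `h t`. Up to distance `L`, separation
    -- leaves no further element of `α` and at most one of `β`, which costs at most `H`; every other
    -- position after `t` costs at most `V`.
    separated-positive : ∀ α β → Separated L α → Separated L β → (∀ s → s ℕ.< t → α s ≡ β s) →
      α t ≡ true → β t ≡ false → 0ℤ < Σ< (t ℕ.+ suc N) (λ s → bits-difference (α s) (β s) (h s))
    separated-positive α β sepα sepβ agree αt βt =
      subst (0ℤ <_) (sym total)
        (<-≤-trans (subst (_< h t - (H + + N * V)) (+-inverseʳ (H + + N * V)) (+-monoˡ-< (- (H + + N * V)) big))
          (+-monoʳ-≤ (h t) (Σ<-≥-except N g H V 0≤H 0≤V low)))
      where
      d g : ℕ → ℤ
      d s = bits-difference (α s) (β s) (h s)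
      g j = d (t ℕ.+ suc j)

      same : ∀ b x → bits-difference b b x ≡ 0ℤ
      same true  = difference-tt
      same false = difference-ff

      total : Σ< (t ℕ.+ suc N) d ≡ h t + Σ< N g
      total = begin
        Σ< (t ℕ.+ suc N) d                ≡⟨ Σ<-split t (suc N) d ⟩
        Σ< t d + (d (t ℕ.+ 0) + Σ< N g)
          ≡⟨ cong₂ (λ x s → x + (d s + Σ< N g))
               (Σ<-zero t λ s s<t → trans (cong (λ b → bits-difference b (β s) (h s)) (agree s s<t)) (same (β s) (h s)))
               (ℕ.+-identityʳ t) ⟩
        0ℤ + (d t + Σ< N g)               ≡⟨ +-identityˡ _ ⟩
        d t + Σ< N g                      ≡⟨ cong₂ (λ b c → bits-difference b c (h t) + Σ< N g) αt βt ⟩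
        bits-difference true false (h t) + Σ< N g ≡⟨ cong (λ x → x + Σ< N g) (difference-tf (h t)) ⟩
        h t + Σ< N g ∎
        where open ≡-Reasoning

      α-near : ∀ j → suc j ℕ.≤ L → α (t ℕ.+ suc j) ≡ false
      α-near j j<L = ¬-not λ eq → sepα t (suc j) (ℕ.s≤s ℕ.z≤n) j<L αt eq

      far-low : ∀ j → L ℕ.< suc j → j ℕ.< N → - V ≤ g j
      far-low j L<j j<N = difference-≥ (α (t ℕ.+ suc j)) (β (t ℕ.+ suc j)) 0≤V (proj₁ (far (suc j) L<j j<N)) (proj₂ (far (suc j) L<j j<N))

      absent : ∀ {b c x} → b ≡ false → c ≡ false → - V ≤ bits-difference b c x
      absent {x = x} refl refl = subst (- V ≤_) (sym (difference-ff x)) (neg-mono-≤ 0≤V)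

      low : ∀ j → j ℕ.< N → - V ≤ g j ⊎ (- H ≤ g j × (∀ j′ → j ℕ.< j′ → j′ ℕ.< N → - V ≤ g j′))
      low j j<N with suc j ℕ.≤? L
      ... | no  j≮L = inj₁ (far-low j (ℕ.≰⇒> j≮L) j<N)
      ... | yes j<L with β (t ℕ.+ suc j) in βj
      ...   | false = inj₁ (absent (α-near j j<L) refl)
      ...   | true  rewrite α-near j j<L = inj₂
        ( subst (- H ≤_) (sym (difference-ft (h (t ℕ.+ suc j)))) (neg-mono-≤ (proj₂ (near (suc j) (ℕ.s≤s ℕ.z≤n) j<L)))
        , later )
        where
        later : ∀ j′ → j ℕ.< j′ → j′ ℕ.< N → - V ≤ g j′
        later j′ j<j′ j′<N with suc j′ ℕ.≤? L
        ... | no  j′≮L = far-low j′ (ℕ.≰⇒> j′≮L) j′<N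
        ... | yes j′<L = absent (α-near j′ j′<L) β-later
          where
          gap : t ℕ.+ suc j ℕ.+ (j′ ℕ.∸ j) ≡ t ℕ.+ suc j′
          gap = trans (ℕ.+-assoc t (suc j) _) (cong (λ x → t ℕ.+ suc x) (ℕ.m+[n∸m]≡n (ℕ.<⇒≤ j<j′)))
          β-later : β (t ℕ.+ suc j′) ≡ false
          β-later = ¬-not λ eq → sepβ (t ℕ.+ suc j) (j′ ℕ.∸ j) (ℕ.m<n⇒0<n∸m j<j′)
            (ℕ.≤-trans (ℕ.m∸n≤m j′ j) (ℕ.<⇒≤ j′<L)) βj (trans (cong β gap) eq)

    separated-nonZero : ∀ α β → Separated L α → Separated L β → (∀ s → s ℕ.< t → α s ≡ β s) →
      α t ≢ β t → Σ< (t ℕ.+ suc N) (λ s → bits-difference (α s) (β s) (h s)) ≢ 0ℤ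
    separated-nonZero α β sepα sepβ agree α≢β Σ≡0 with α t in αt | β t in βt
    ... | true  | true  = α≢β refl
    ... | false | false = α≢β refl
    ... | true  | false = <⇒≢ (separated-positive α β sepα sepβ agree αt βt) (sym Σ≡0)
    ... | false | true  = <⇒≢ (separated-positive β α sepβ sepα (λ s s<t → sym (agree s s<t)) βt αt)
      (sym (begin
        Σ< (t ℕ.+ suc N) (λ s → bits-difference (β s) (α s) (h s))
          ≡⟨ Σ<-cong (t ℕ.+ suc N) (λ s _ → difference-neg (β s) (α s) (h s)) ⟩
        Σ< (t ℕ.+ suc N) (λ s → - bits-difference (α s) (β s) (h s))
          ≡⟨ Σ<-neg (t ℕ.+ suc N) (λ s → bits-difference (α s) (β s) (h s)) ⟩
        - Σ< (t ℕ.+ suc N) (λ s → bits-difference (α s) (β s) (h s)) ≡⟨ cong -_ Σ≡0 ⟩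
        0ℤ ∎))
      where open ≡-Reasoning

  -- As a function of `a`, this is the Chebyshev polynomial of degree 2 ^ i at (c - 2a) / v, cleared
  -- of denominators. The factor 2 sends an interval of length `v` to one of length 2, without
  -- fractions.
  weight : ℕ → ℤ → ℤ → ℤ → ℤ
  weight i v c a = cheb i (c - + 2 * a) v

  weight-periodic : ∀ i v c r a → r ∣ weight i v c a - weight i v c (a + r)
  weight-periodic i v c r a = cheb-cong i _ _ v (subst (r ∣_) (l c a r) (∣n⇒∣m*n (+ 2) ∣-refl))
    where
    l : ∀ c a r → + 2 * r ≡ (c - + 2 * a) - (c - + 2 * (a + r))
    l = solve-∀

  ∣i∣≤ : ∀ {i B} → - + B ≤ i → i ≤ + B → ∣ i ∣ ℕ.≤ B
  ∣i∣≤ {+ n}      {B} low (+≤+ n≤B) = n≤B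
  ∣i∣≤ { -[1+ n ]} {B} low up = drop‿+≤+ (subst (+ suc n ≤_) (neg-involutive (+ B)) (neg-mono-≤ low))

  2*^-pos : ∀ c → + 2 * + (2 ℕ.^ c) ≡ + (2 ℕ.^ suc c)
  2*^-pos c = sym (pos-* 2 (2 ℕ.^ c))

  ∣weight∣≤ : ∀ i a c C s → 2 ℕ.^ a ℕ.≤ 2 ℕ.^ c → C ℕ.≤ 2 ℕ.^ c → 2 ℕ.* s ℕ.≤ 2 ℕ.^ c →
    ∣ weight i (+ (2 ℕ.^ a)) (+ C) (+ s) ∣ ℕ.≤ 2 ℕ.^ (suc c ℕ.* 2 ℕ.^ i)
  ∣weight∣≤ i a c C s a≤c C≤ s≤ = ℕ.≤-trans (ℕ.m≤n*m ∣ x ∣ 2)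
    (subst (ℕ._≤ 2 ℕ.^ (suc c ℕ.* 2 ℕ.^ i)) (abs-* (+ 2) x) (∣i∣≤ (proj₁ bound) (proj₂ bound)))
    where
    x = weight i (+ (2 ℕ.^ a)) (+ C) (+ s)
    s≤′ : + 2 * + s ≤ + (2 ℕ.^ c)
    s≤′ = subst (_≤ + (2 ℕ.^ c)) (pos-* 2 s) (+≤+ s≤)
    tower≡ : tower i (+ 2 * + (2 ℕ.^ c)) ≡ + (2 ℕ.^ (suc c ℕ.* 2 ℕ.^ i))
    tower≡ = trans (cong (tower i) (2*^-pos c)) (tower-2^ i (suc c))
    bound : - + (2 ℕ.^ (suc c ℕ.* 2 ℕ.^ i)) ≤ + 2 * x × + 2 * x ≤ + (2 ℕ.^ (suc c ℕ.* 2 ℕ.^ i))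
    bound = subst (λ y → - y ≤ + 2 * x × + 2 * x ≤ y) tower≡
      (cheb-crude i 0≤+ (+≤+ a≤c)
        (≤-by (+ C + (+ (2 ℕ.^ c) - + 2 * + s)) (+-nonNeg {+ C} 0≤+ (i≤j⇒0≤j-i s≤′)) (l₁ (+ C) (+ (2 ℕ.^ c)) (+ s)))
        (≤-by ((+ (2 ℕ.^ c) - + C) + + 2 * + s) (+-nonNeg (i≤j⇒0≤j-i (+≤+ C≤)) (*-nonNeg {+ 2} {+ s} 0≤+ 0≤+)) (l₂ (+ C) (+ (2 ℕ.^ c)) (+ s))))
      where
      l₁ : ∀ C c s → (C - + 2 * s) - - c ≡ C + (c - + 2 * s)
      l₁ = solve-∀
      l₂ : ∀ C c s → c - (C - + 2 * s) ≡ (c - C) + + 2 * s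
      l₂ = solve-∀

  -- These are the two phases of `cheb-gap`. At `t` the argument exceeds 1 by 2L / v; `scale` says
  -- that `k` iterations lift such an argument to 2, and `excess` that `e` more make the drop from
  -- `t` to the next position exceed N bounded terms.
  module Weighted (a k e L t N : ℕ) (1≤L : 1 ℕ.≤ L) (N≤v : N ℕ.≤ 2 ℕ.^ a)
           (scale : 2 ℕ.^ a ℕ.≤ 4 ℕ.^ k ℕ.* (2 ℕ.* L)) (excess : N ℕ.* 2 ℕ.^ a ℕ.< 2 ℕ.^ (2 ℕ.^ e)) where

    v : ℤ
    v = + (2 ℕ.^ a)

    -- With this choice the interval [t + L, t + L + v] of positions is mapped
    -- to [-1, 1], in reverse.
    centre : ℕ
    centre = 2 ℕ.^ a ℕ.+ 2 ℕ.* (L ℕ.+ t)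

    h : ℕ → ℤ
    h s = weight (k ℕ.+ e) v (+ centre) (+ s)

    private
      at-offset : ∀ j → + centre - + 2 * + (t ℕ.+ j) ≡ v + + 2 * (+ L - + j)
      at-offset j = trans (cong₂ (λ x y → v + x - + 2 * y) (pos-* 2 (L ℕ.+ t)) (pos-+ t j))
          (trans (cong (λ x → v + + 2 * x - + 2 * (+ t + + j)) (pos-+ L t)) (l v (+ L) (+ t) (+ j)))
        where
        l : ∀ v L t j → v + + 2 * (L + t) - + 2 * (t + j) ≡ v + + 2 * (L - j)
        l = solve-∀

      h-offset : ∀ j → h (t ℕ.+ j) ≡ cheb (k ℕ.+ e) (v + + 2 * (+ L - + j)) v
      h-offset j = cong (λ u → cheb (k ℕ.+ e) u v) (at-offset j)

      ht : h t ≡ cheb (k ℕ.+ e) (v + + 2 * + L) v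
      ht = trans (cong h (sym (ℕ.+-identityʳ t))) (trans (h-offset 0) (cong (λ u → cheb (k ℕ.+ e) (v + + 2 * u) v) (+-identityʳ (+ L))))

      V H : ℤ
      V = tower (k ℕ.+ e) v
      H = cheb (k ℕ.+ e) (v + + 2 * (+ L - 1ℤ)) v

      0≤v : 0ℤ ≤ v
      0≤v = 0≤+
      0<V : 0ℤ < V
      0<V = subst (0ℤ <_) (sym (tower-2^ (k ℕ.+ e) a)) (+<+ (ℕ.m^n>0 2 (a ℕ.* 2 ℕ.^ (k ℕ.+ e))))

      v≤u : ∀ j → j ℕ.≤ L → v ≤ v + + 2 * (+ L - + j)
      v≤u j j≤L = ≤-by (+ 2 * (+ L - + j)) (*-nonNeg {+ 2} 0≤+ (i≤j⇒0≤j-i (+≤+ j≤L))) (l v _)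
        where
        l : ∀ v x → (v + x) - v ≡ x
        l = solve-∀

      near : ∀ j → 1 ℕ.≤ j → j ℕ.≤ L → 0ℤ ≤ h (t ℕ.+ j) × h (t ℕ.+ j) ≤ H
      near j 1≤j j≤L rewrite h-offset j =
        let low , up = cheb-mono (k ℕ.+ e) 0≤v (v≤u j j≤L)
              (≤-by (+ 2 * (+ j - 1ℤ)) (*-nonNeg {+ 2} 0≤+ (i≤j⇒0≤j-i (+≤+ 1≤j))) (l v (+ L) (+ j)))
        in ≤-trans (<⇒≤ 0<V) low , up
        where
        l : ∀ v L j → (v + + 2 * (L - 1ℤ)) - (v + + 2 * (L - j)) ≡ + 2 * (j - 1ℤ)
        l = solve-∀

      far : ∀ j → L ℕ.< j → j ℕ.≤ N → - V ≤ h (t ℕ.+ j) × h (t ℕ.+ j) ≤ V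
      far j L<j j≤N rewrite h-offset j = cheb-inside (k ℕ.+ e) 0≤v
        (≤-by (+ 2 * (v - + j) + + 2 * + L) (+-nonNeg (*-nonNeg {+ 2} 0≤+ (i≤j⇒0≤j-i (+≤+ (ℕ.≤-trans j≤N N≤v)))) (*-nonNeg {+ 2} {+ L} 0≤+ 0≤+)) (l₁ v (+ L) (+ j)))
        (≤-by (+ 2 * (+ j - + L)) (*-nonNeg {+ 2} 0≤+ (i≤j⇒0≤j-i (+≤+ (ℕ.<⇒≤ L<j)))) (l₂ v (+ L) (+ j)))
        where
        l₁ : ∀ v L j → (v + + 2 * (L - j)) - - v ≡ + 2 * (v - j) + + 2 * L
        l₁ = solve-∀
        l₂ : ∀ v L j → v - (v + + 2 * (L - j)) ≡ + 2 * (j - L)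
        l₂ = solve-∀

      -- Neighbouring positions have arguments only 2 / v apart, so `cheb-gap` is used with `J = v`;
      -- that factor `v` is what `excess` has to absorb.
      gap : + (2 ℕ.^ (2 ℕ.^ e)) * V ≤ v * (h t - H)
      gap = subst₂ (λ x y → x * V ≤ v * (y - H))
        (trans (tower-2^ e 1) (cong (λ x → + (2 ℕ.^ x)) (ℕ.*-identityˡ (2 ℕ.^ e)))) (sym ht)
        (cheb-gap k e 0≤v 0≤v (v≤u 1 1≤L) (≤-by (+ 2) 0≤+ (l₁ v (+ L))) scale′
          (≤-by 0ℤ ≤-refl (l₂ v (+ L))))
        where
        l₁ : ∀ v L → (v + + 2 * L) - (v + + 2 * (L - 1ℤ)) ≡ + 2
        l₁ = solve-∀
        l₂ : ∀ v L → v * (v + + 2 * L - (v + + 2 * (L - 1ℤ))) - + 2 * v ≡ 0ℤ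
        l₂ = solve-∀
        l₃ : ∀ v L → L ≡ v + L - v
        l₃ = solve-∀
        scale′ : v ≤ + (4 ℕ.^ k) * (v + + 2 * + L - v)
        scale′ = subst (v ≤_)
          (trans (pos-* (4 ℕ.^ k) (2 ℕ.* L)) (cong (_*_ (+ (4 ℕ.^ k))) (trans (pos-* 2 L) (l₃ v (+ 2 * + L))))) (+≤+ scale)

      big : H + + N * V < h t
      big with + N * V <? h t - H
      ... | yes lt = subst₂ _<_ (+-comm (+ N * V) H) (l (h t) H) (+-monoˡ-< H lt)
        where
        l : ∀ x y → x - y + y ≡ x
        l = solve-∀
      ... | no ¬lt = contradiction (≤-<-trans (≤-trans gap (*-monoˡ-≤-nonNeg v (≮⇒≥ ¬lt)))
              (subst (_< + (2 ℕ.^ (2 ℕ.^ e)) * V) (l v (+ N) V) (*-monoʳ-<-pos V {{positive 0<V}} excess′))) (<-irrefl refl)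
        where
        l : ∀ v N V → (N * v) * V ≡ v * (N * V)
        l = solve-∀
        excess′ : + N * v < + (2 ℕ.^ (2 ℕ.^ e))
        excess′ = subst (_< + (2 ℕ.^ (2 ℕ.^ e))) (pos-* N (2 ℕ.^ a)) (+<+ excess)

    weighted-nonZero : ∀ α β → Separated L α → Separated L β → (∀ s → s ℕ.< t → α s ≡ β s) →
      α t ≢ β t → Σ< (t ℕ.+ suc N) (λ s → bits-difference (α s) (β s) (h s)) ≢ 0ℤ
    weighted-nonZero = separated-nonZero {t} {L} {N} h {H} {V} (<⇒≤ 0<V)
      (≤-trans (<⇒≤ 0<V) (proj₁ (cheb-mono (k ℕ.+ e) 0≤v (v≤u 1 1≤L) ≤-refl))) near far big

-- Patterns without short periods.

module AperiodicPatterns where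

  open import Data.Bool using (Bool; true; false; if_then_else_)
  import Data.Bool.Properties as Bool
  open import Data.Empty using (⊥)
  open import Data.List using (List; []; _∷_; length; replicate; _++_)
  open import Data.Maybe using (just; fromMaybe)
  open import Data.Maybe.Properties using (just-injective)
  open import Data.Nat
  open import Data.Nat.Properties
  open import Data.Product using (∃-syntax; _×_; _,_; proj₁; proj₂)
  open import Data.Sum using (_⊎_; inj₁; inj₂)
  open import Data.Vec using (Vec; []; _∷_; toList)
  open import Data.Vec.Properties using (length-toList)
  open import Function using (_∘_; mk⇔)
  open import Relation.Binary.PropositionalEquality
  open import Relation.Nullary
  open import Relation.Nullary.Decidable using (dec-true; dec-false)
  open import Data.Nat.Tactic.RingSolver using (solve-∀)
  open PatternCounting
  open SeparatedSets using (Separated)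


  -- Bounding `i` by a number makes the property decidable by bounded search.
  Period : ℕ → (ℕ → Bool) → ℕ → Set
  Period W w p = ∀ {i} → i < suc W ∸ p → w i ≡ w (i + p)

  period-at : ∀ {W w p} → Period W w p → ∀ {i} → i + p ≤ W → w i ≡ w (i + p)
  period-at per {i} i+p≤W = per (m+n≤o⇒m≤o∸n (suc i) (s≤s i+p≤W))

  Aperiodic : ℕ → ℕ → (ℕ → Bool) → Set
  Aperiodic L W w = ∀ p → 1 ≤ p → p ≤ L → ¬ Period W w p

  extend : ℕ → (ℕ → Bool) → Bool → ℕ → Bool
  extend W v b i = if does (i <? W) then v i else b

  extend-< : ∀ {W} v b {i} → i < W → extend W v b i ≡ v i
  extend-< {W} v b {i} i<W rewrite dec-true (i <? W) i<W = refl

  extend-last : ∀ W v b → extend W v b W ≡ b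
  extend-last W v b rewrite dec-false (W <? W) (<-irrefl refl) = refl

  -- If v0 had period p and v1 period q, then the letters of v at distance
  -- p and at distance q from its end would both equal the one at distance
  -- p + q.
  extend-aperiodic : ∀ L v {p q} → 1 ≤ p → p ≤ L → 1 ≤ q → q ≤ L →
    Period (L + L) (extend (L + L) v false) p → ¬ Period (L + L) (extend (L + L) v true) q
  extend-aperiodic L v {p} {q} 1≤p p≤L 1≤q q≤L per₀ per₁ = contradiction (begin
    false                     ≡⟨ extend-last W v false ⟨
    extend W v false W        ≡⟨ cong (extend W v false) (sym W≡₀) ⟩
    extend W v false (m + q + p) ≡⟨ period-at per₀ (≤-reflexive W≡₀) ⟨
    extend W v false (m + q)  ≡⟨ extend-< v false m+q<W ⟩
    v (m + q)                 ≡⟨ extend-< v true m+q<W ⟨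
    extend W v true (m + q)   ≡⟨ period-at per₁ (<⇒≤ m+q<W) ⟨
    extend W v true m         ≡⟨ extend-< v true m<W ⟩
    v m                       ≡⟨ extend-< v false m<W ⟨
    extend W v false m        ≡⟨ period-at per₀ (<⇒≤ m+p<W) ⟩
    extend W v false (m + p)  ≡⟨ extend-< v false m+p<W ⟩
    v (m + p)                 ≡⟨ extend-< v true m+p<W ⟨
    extend W v true (m + p)   ≡⟨ period-at per₁ (≤-reflexive W≡₁) ⟩
    extend W v true (m + p + q) ≡⟨ cong (extend W v true) W≡₁ ⟩
    extend W v true W         ≡⟨ extend-last W v true ⟩
    true                      ∎) λ ()
    where
    open ≡-Reasoning
    W = L + L
    m = W ∸ (p + q)
    W≡₁ : m + p + q ≡ W
    W≡₁ = trans (+-assoc m p q) (m∸n+n≡m (+-mono-≤ p≤L q≤L))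
    W≡₀ : m + q + p ≡ W
    W≡₀ = trans (l m q p) W≡₁
      where
      l : ∀ m q p → m + q + p ≡ m + p + q
      l = solve-∀
    m+q<W : m + q < W
    m+q<W = subst (m + q <_) W≡₀ (m<m+n (m + q) 1≤p)
    m+p<W : m + p < W
    m+p<W = subst (m + p <_) W≡₁ (m<m+n (m + p) 1≤q)
    m<W : m < W
    m<W = ≤-<-trans (m≤m+n m p) m+p<W

  -- The letters before the first difference are forced, and only the last letter of the pattern is
  -- free. The length `L + L` of the forced part is what lets two periods up to `L` be combined.
  aperiodic-extension : ∀ L v → ∃[ b ] Aperiodic L (L + L) (extend (L + L) v b)
  aperiodic-extension L v with anyUpTo? (λ p → allUpTo? (λ i → w i Bool.≟ w (i + suc p)) (suc (L + L) ∸ suc p)) L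
    where w = extend (L + L) v false
  ... | no ∄ = false , λ { (suc p) _ p<L per → ∄ (p , p<L , per) }
  ... | yes (p , p<L , per₀) = true , λ q 1≤q q≤L → extend-aperiodic L v {suc p} {q} (s≤s z≤n) p<L 1≤q q≤L per₀

  -- Two occurrences at distance p ≤ W overlap, and their overlap forces the period p on the
  -- pattern.
  occurs-separated : ∀ {L W w} → L ≤ W → Aperiodic L W w → ∀ xs → Separated L (Pattern.occurs W w xs)
  occurs-separated {L} {W} {w} L≤W aper xs s p 1≤p p≤L occ occ′ = aper p 1≤p p≤L λ {i} i< →
    let i+p≤W = s≤s⁻¹ (m≤o∸n⇒m+n≤o (suc i) (m≤n⇒m≤1+n (≤-trans p≤L L≤W)) i<) in
    just-injective (begin
      just (w i)           ≡⟨ true-occurs xs (s + p) occ′ i (≤-trans (m≤m+n i p) i+p≤W) ⟨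
      at xs (s + p + i)    ≡⟨ cong (at xs) (trans (+-assoc s p i) (cong (s +_) (+-comm p i))) ⟩
      at xs (s + (i + p))  ≡⟨ true-occurs xs s occ (i + p) i+p≤W ⟩
      just (w (i + p))     ∎)
    where
    open Pattern W w
    open ≡-Reasoning

  occurs-cong : ∀ W w s xs ys → (∀ i → i ≤ W → at xs (s + i) ≡ at ys (s + i)) →
                Pattern.occurs W w xs s ≡ Pattern.occurs W w ys s
  occurs-cong W w s xs ys eq = Bool.⇔→≡ {z = true} (mk⇔
    (λ occ → occurs-true ys s λ i i≤W → trans (sym (eq i i≤W)) (true-occurs xs s occ i i≤W))
    (λ occ → occurs-true xs s λ i i≤W → trans (eq i i≤W) (true-occurs ys s occ i i≤W)))
    where open Pattern W w

  at-< : ∀ xs i → i < length xs → ∃[ b ] at xs i ≡ just b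
  at-< (b ∷ xs) zero    _         = b , refl
  at-< (b ∷ xs) (suc i) (s≤s i<n) = at-< xs i i<n

  -- Over two letters, one of two distinct last letters must be `w W`, so the pattern occurs at `t`
  -- in exactly one of the words.
  occurs-distinct : ∀ W w t xs ys → t + W < length xs → t + W < length ys →
    (∀ i → i < W → at xs (t + i) ≡ just (w i)) → (∀ i → i < W → at ys (t + i) ≡ just (w i)) →
    at xs (t + W) ≢ at ys (t + W) → Pattern.occurs W w xs t ≢ Pattern.occurs W w ys t
  occurs-distinct W w t xs ys xs< ys< xs≡ ys≡ differ same
    with at-< xs (t + W) xs< | at-< ys (t + W) ys<
  ... | b , xs≡b | c , ys≡c = case (b Bool.≟ w W) (c Bool.≟ w W)
    where
    open Pattern W w

    present : ∀ zs → (∀ i → i < W → at zs (t + i) ≡ just (w i)) → at zs (t + W) ≡ just (w W) → occurs zs t ≡ true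
    present zs zs≡ last = occurs-true zs t λ i i≤W → letter i (m≤n⇒m<n∨m≡n i≤W)
      where
      letter : ∀ i → i < W ⊎ i ≡ W → at zs (t + i) ≡ just (w i)
      letter i (inj₁ i<W)  = zs≡ i i<W
      letter i (inj₂ refl) = last

    case : Dec (b ≡ w W) → Dec (c ≡ w W) → ⊥
    case (yes b≡) _ = differ (trans last (sym (true-occurs ys t (trans (sym same) (present xs xs≡ last)) W ≤-refl)))
      where last = trans xs≡b (cong just b≡)
    case _ (yes c≡) = differ (trans (true-occurs xs t (trans same (present ys ys≡ last)) W ≤-refl) (sym last))
      where last = trans ys≡c (cong just c≡)
    case (no b≢) (no c≢) = differ (trans xs≡b (trans (cong just (trans (Bool.¬-not b≢) (sym (Bool.¬-not c≢)))) (sym ys≡c)))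

  record Distinguished (L t : ℕ) (xs ys : List Bool) : Set where
    field
      w : ℕ → Bool
    open Pattern (L + L) w using (occurs)
    field
      separatedˡ : Separated L (occurs xs)
      separatedʳ : Separated L (occurs ys)
      before     : ∀ s → s < t → occurs xs s ≡ occurs ys s
      here       : occurs xs t ≢ occurs ys t

  distinguish : ∀ L t xs ys → t + (L + L) < length xs → t + (L + L) < length ys →
    (∀ i → i < t + (L + L) → at xs i ≡ at ys i) → at xs (t + (L + L)) ≢ at ys (t + (L + L)) → Distinguished L t xs ys
  distinguish L t xs ys xs< ys< agree differ = record
    { w = w
    ; separatedˡ = occurs-separated (m≤m+n L L) aper xs
    ; separatedʳ = occurs-separated (m≤m+n L L) aper ys
    ; before = λ s s<t → occurs-cong W w s xs ys λ i i≤W → agree (s + i) (+-mono-<-≤ s<t i≤W)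
    ; here = occurs-distinct W w t xs ys xs< ys< xs≡
        (λ i i<W → trans (sym (agree (t + i) (+-monoʳ-< t i<W))) (xs≡ i i<W)) differ
    }
    where
    W = L + L
    v : ℕ → Bool
    v i = fromMaybe false (at xs (t + i))
    b = proj₁ (aperiodic-extension L v)
    aper = proj₂ (aperiodic-extension L v)
    w = extend W v b
    xs≡ : ∀ i → i < W → at xs (t + i) ≡ just (w i)
    xs≡ i i<W with at-< xs (t + i) (<-trans (+-monoʳ-< t i<W) xs<)
    ... | c , eq = trans eq (cong just (sym (trans (extend-< v b i<W) (cong (fromMaybe false) eq))))

  firstDifference : ∀ {n} (x y : Vec Bool n) → x ≢ y →
    ∃[ t ] t < n × (∀ i → i < t → at (toList x) i ≡ at (toList y) i) × at (toList x) t ≢ at (toList y) t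
  firstDifference []      []      x≢y = contradiction refl x≢y
  firstDifference (b ∷ x) (c ∷ y) x≢y with b Bool.≟ c
  ... | no  b≢c  = 0 , s≤s z≤n , (λ _ ()) , b≢c ∘ just-injective
  ... | yes refl with firstDifference x y (x≢y ∘ cong (b ∷_))
  ...   | t , t<n , agree , differ = suc t , s≤s t<n , (λ { zero _ → refl ; (suc i) (s≤s i<t) → agree i i<t }) , differ

  -- The padding makes room for the window that ends at the first difference.
  pad : ∀ {n} → ℕ → Vec Bool n → List Bool
  pad W x = replicate W false ++ toList x

  length-pad : ∀ {n} W (x : Vec Bool n) → length (pad W x) ≡ W + n
  length-pad zero    x = length-toList x
  length-pad (suc W) x = cong suc (length-pad W x)

  at-pad : ∀ {n} W (x : Vec Bool n) i → at (pad W x) (W + i) ≡ at (toList x) i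
  at-pad zero    x i = refl
  at-pad (suc W) x i = at-pad W x i

  pad-agree : ∀ {n} W (x y : Vec Bool n) t → (∀ i → i < t → at (toList x) i ≡ at (toList y) i) →
              ∀ i → i < t + W → at (pad W x) i ≡ at (pad W y) i
  pad-agree zero    x y t agree i       i<  = agree i (subst (i <_) (+-identityʳ t) i<)
  pad-agree (suc W) x y t agree zero    i<  = refl
  pad-agree (suc W) x y t agree (suc i) i<  = pad-agree W x y t agree i (s≤s⁻¹ (subst (suc i <_) (+-suc t W) i<))

  pad-distinguish : ∀ {n} L (x y : Vec Bool n) → x ≢ y →
    ∃[ t ] t < n × Distinguished L t (pad (L + L) x) (pad (L + L) y)
  pad-distinguish {n} L x y x≢y with firstDifference x y x≢y
  ... | t , t<n , agree , differ = t , t<n , distinguish L t (pad W x) (pad W y) (inside x) (inside y)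
    (pad-agree W x y t agree) λ eq → differ (trans (sym (here x)) (trans eq (here y)))
    where
    W = L + L
    inside : (x : Vec Bool n) → t + W < length (pad W x)
    inside x = subst (t + W <_) (trans (+-comm n W) (sym (length-pad W x))) (+-monoˡ-< W t<n)
    here : (x : Vec Bool n) → at (pad W x) (t + W) ≡ at (toList x) t
    here x = trans (cong (at (pad W x)) (+-comm t W)) (at-pad W x t)

-- The automaton, the choice of parameters and the number of states.

module Automata where

  open import Defs using (DFA; Accepts)
  open import Data.Bool using (Bool; true; false; if_then_else_)
  open import Data.Fin using (toℕ; fromℕ<)
  open import Data.Fin.Properties using (toℕ-fromℕ<; *↔×; 2↔Bool)
  open import Data.Integer as ℤ using (ℤ; +_; 0ℤ)
  import Data.Integer.Properties as ℤ
  import Data.Integer.Divisibility.Signed as ℤ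
  open import Data.List using (List; []; _∷_; length; replicate; foldl)
  open import Data.List.Properties using (foldl-++)
  open import Data.Nat
  open import Data.Nat.Properties
  open import Data.Nat.DivMod using (_%_; _/_; m≡m%n+[m/n]*n; m%n<n)
  open import Data.Nat.Divisibility
  open import Data.Product using (Σ-syntax; ∃-syntax; _×_; _,_)
  open import Data.Product.Function.NonDependent.Propositional using (_×-↔_)
  open import Data.Sum using (inj₁; inj₂)
  open import Data.Vec as Vec using (Vec; []; _∷_; toList; foldl′)
  open import Function using (_∘_)
  open import Function.Properties.Inverse using (↔-refl; ↔-sym; ↔-trans)
  open import Relation.Binary.PropositionalEquality
  open import Relation.Nullary
  open import Data.Nat.Tactic.RingSolver using (solve-∀)
  open CommonMultiples
  open PatternCounting
  open ChebyshevWeights using (Σ<; Σ<-cong; Σ<-minus; residueSums-combine)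
  open SeparatedSets
  open AperiodicPatterns


  foldl′-toList : ∀ {A B : Set} {n} (f : B → A → B) z (x : Vec A n) → foldl′ f z x ≡ foldl f z (toList x)
  foldl′-toList f z []      = refl
  foldl′-toList f z (b ∷ x) = foldl′-toList f (f z b) x

  floor-log : ∀ b → 2 ≤ b → ∀ n → 1 ≤ n → ∃[ m ] b ^ m ≤ n × n < b ^ suc m
  floor-log b 2≤b (suc zero) _ = 0 , ≤-refl , subst (1 <_) (sym (*-identityʳ b)) 2≤b
  floor-log b 2≤b (suc (suc n)) _ with floor-log b 2≤b (suc n) (s≤s z≤n)
  ... | m , low , up with suc (suc n) <? b ^ suc m
  ...   | yes up′ = m , m≤n⇒m≤1+n low , up′
  ...   | no  ¬up = suc m , ≮⇒≥ ¬up , ≤-<-trans up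
    (subst (_< b ^ suc (suc m)) (*-identityˡ (b ^ suc m))
      (*-monoˡ-< (b ^ suc m) {{m^n≢0 b (suc m) {{>-nonZero (<-trans z<s 2≤b)}}}} 2≤b))

  %-≡⇒∣ : ∀ m n q .{{_ : NonZero q}} → m % q ≡ n % q → q ∣ ∣ m - n ∣
  %-≡⇒∣ m n q eq = divides ∣ m / q - n / q ∣ (begin
    ∣ m - n ∣                                      ≡⟨ cong₂ ∣_-_∣ (m≡m%n+[m/n]*n m q) (m≡m%n+[m/n]*n n q) ⟩
    ∣ m % q + m / q * q - n % q + n / q * q ∣      ≡⟨ cong (λ x → ∣ m % q + m / q * q - x + n / q * q ∣) eq ⟨
    ∣ m % q + m / q * q - m % q + n / q * q ∣      ≡⟨ ∣m+n-m+o∣≡∣n-o∣ (m % q) _ _ ⟩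
    ∣ m / q * q - n / q * q ∣                      ≡⟨ *-distribʳ-∣-∣ q (m / q) (n / q) ⟨
    ∣ m / q - n / q ∣ * q                          ∎)
    where open ≡-Reasoning

  -- The non-divisor found may be smaller than the pattern, whereas the counter needs `W < r`.
  -- Multiples of a non-divisor of `D` are again non-divisors, so it can be replaced by one that is
  -- large enough, at the cost of a factor 2 in the bound.
  multiple-between : ∀ r R → 1 ≤ r → r ≤ R → ∃[ s ] r ∣ s × R < s × s ≤ R + R
  multiple-between r@(suc _) R _ r≤R = r + R / r * r , ∣m∣n⇒∣m+n ∣-refl (divides (R / r) refl)
    , (begin-strict
        R                     ≡⟨ m≡m%n+[m/n]*n R r ⟩
        R % r + R / r * r     <⟨ +-monoˡ-< (R / r * r) (m%n<n R r) ⟩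
        r + R / r * r         ∎)
    , +-mono-≤ r≤R (begin
        R / r * r             ≤⟨ m≤n+m _ (R % r) ⟩
        R % r + R / r * r     ≡⟨ m≡m%n+[m/n]*n R r ⟨
        R                     ∎)
    where open ≤-Reasoning

  residueSum-≤ : ∀ r .{{_ : NonZero r}} c n (α : ℕ → Bool) → residueSum r c n (bit ∘ α) ≤ n
  residueSum-≤ r c zero    α = z≤n
  residueSum-≤ r c (suc n) α = +-mono-≤ (at-most-one (does (c ≟ 0)) (α 0)) (residueSum-≤ r (suc c % r) n (α ∘ suc))
    where
    at-most-one : ∀ b d → (if b then bit d else 0) ≤ 1
    at-most-one true  true  = ≤-refl
    at-most-one true  false = z≤n
    at-most-one false d     = z≤n

  -- Both `S α - E α` and `S β - E β` are multiples of `r`; if the counts coincide, `S` cancels from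
  -- their difference.
  residueSums-coincide⇒∣ : ∀ r .{{_ : NonZero r}} h → (∀ a → + r ℤ.∣ h a ℤ.- h (a ℤ.+ + r)) → ∀ n α β →
    (∀ c → c < r → residueSum r c n (bit ∘ α) ≡ residueSum r c n (bit ∘ β)) →
    + r ℤ.∣ Σ< n (λ s → bits-difference (α s) (β s) (h (+ s)))
  residueSums-coincide⇒∣ r h periodic n α β coincide =
    subst (+ r ℤ.∣_) difference (ℤ.∣m∣n⇒∣m-n (divisible β) (divisible α))
    where
    S : (ℕ → Bool) → ℤ
    S α = Σ< r (λ c → h (0ℤ ℤ.- + c) ℤ.* + residueSum r c n (bit ∘ α))
    E : (ℕ → Bool) → ℤ
    E α = Σ< n (λ s → + bit (α s) ℤ.* h (+ s))
    divisible : ∀ α → + r ℤ.∣ S α ℤ.- E α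
    divisible α = subst (λ x → + r ℤ.∣ S α ℤ.- x)
      (Σ<-cong n λ s _ → cong (λ x → + bit (α s) ℤ.* h x) (ℤ.+-identityˡ (+ s)))
      (residueSums-combine r h periodic n (bit ∘ α) 0ℤ)
    S-coincide : S α ≡ S β
    S-coincide = Σ<-cong r λ c c<r → cong (λ x → h (0ℤ ℤ.- + c) ℤ.* + x) (coincide c c<r)
    difference : (S β ℤ.- E β) ℤ.- (S α ℤ.- E α) ≡ Σ< n (λ s → bits-difference (α s) (β s) (h (+ s)))
    difference = trans (cong (λ x → (S β ℤ.- E β) ℤ.- (x ℤ.- E α)) S-coincide)
      (trans (l (S β) (E α) (E β)) (Σ<-minus n _ _))
      where
      open import Data.Integer.Tactic.RingSolver renaming (solve-∀ to solveℤ)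
      l : ∀ s a b → (s ℤ.- b) ℤ.- (s ℤ.- a) ≡ a ℤ.- b
      l = solveℤ

  residueSums-differ : ∀ r .{{_ : NonZero r}} h → (∀ a → + r ℤ.∣ h a ℤ.- h (a ℤ.+ + r)) → ∀ n α β →
    ¬ r ∣ ℤ.∣ Σ< n (λ s → bits-difference (α s) (β s) (h (+ s))) ∣ →
    ∃[ c ] c < r × residueSum r c n (bit ∘ α) ≢ residueSum r c n (bit ∘ β)
  residueSums-differ r h periodic n α β r∤
    with anyUpTo? (λ c → ¬? (residueSum r c n (bit ∘ α) ≟ residueSum r c n (bit ∘ β))) r
  ... | yes found = found
  ... | no  ∄ = contradiction (ℤ.∣⇒∣ᵤ (residueSums-coincide⇒∣ r h periodic n α β coincide)) r∤
    where
    coincide : ∀ c → c < r → residueSum r c n (bit ∘ α) ≡ residueSum r c n (bit ∘ β)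
    coincide c c<r = decidable-stable (_ ≟ _) λ ne → ∄ (c , c<r , ne)
      where open import Relation.Nullary.Decidable using (decidable-stable)

  -- A word is read as if it were preceded by W letters 0.
  module Machine (W : ℕ) (w : ℕ → Bool) (1≤W : 1 ≤ W) (r q : ℕ) .{{_ : NonZero r}} .{{_ : NonZero q}}
                 (W<r : W < r) {c : ℕ} (c<r : c < r) where
    open Pattern W w
    open Counter r q

    visits : List Bool → ℕ
    visits xs = residueSum r c (length xs) (bit ∘ occurs xs)

    -- If the initial phase lies in 1, ..., W, the run starts inside a window whose beginning
    -- precedes the word; the bit `false` keeps this window from being counted.
    start : State
    start = fromℕ< c<r , false , fromℕ< (>-nonZero⁻¹ q)

    fires-start : ∀ xs → fires c false xs ≡ visits xs
    fires-start xs = go c refl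
      where
      go : ∀ d → d ≡ c → fires c false xs ≡ visits xs
      go zero    refl = fires-idle 1≤W W<r 0 false xs c<r (inj₁ refl)
      go (suc d) refl with suc d ≤? W
      ... | yes d<W = fires-pending 1≤W W<r d (W ∸ suc d) false xs (m+[n∸m]≡n d<W)
      ... | no  d≮W = fires-idle 1≤W W<r (suc d) false xs c<r (inj₂ (≰⇒> d≮W))

    machine : ℕ → DFA
    machine target = record
      { Q      = State
      ; ∣Q∣    = r * (2 * q)
      ; finite = ↔-trans (↔-refl ×-↔ ↔-trans (↔-sym 2↔Bool ×-↔ ↔-refl) (↔-sym *↔×)) (↔-sym *↔×)
      ; δ      = λ (s , b) → step s b
      ; q₁     = foldl step start (replicate W false)
      ; F      = λ s → count s ≡ target
      }

    final : ∀ {n} → Vec Bool n → State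
    final x = foldl′ step (foldl step start (replicate W false)) x

    count-final : ∀ {n} (x : Vec Bool n) → count (final x) ≡ visits (pad W x) % q
    count-final x = begin
      count (final x)  ≡⟨ cong count (trans (foldl′-toList step _ x) (sym (foldl-++ step start (replicate W false) (toList x)))) ⟩
      count (foldl step start (pad W x)) ≡⟨ count-fires (fromℕ< c<r) false (fromℕ< (>-nonZero⁻¹ q)) (pad W x) ⟩
      (fires (toℕ (fromℕ< c<r)) false (pad W x) + toℕ (fromℕ< (>-nonZero⁻¹ q))) % q
        ≡⟨ cong₂ (λ i j → (fires i false (pad W x) + j) % q) (toℕ-fromℕ< c<r) (toℕ-fromℕ< (>-nonZero⁻¹ q)) ⟩
      (fires c false (pad W x) + 0) % q ≡⟨ cong (_% q) (trans (+-identityʳ _) (fires-start (pad W x))) ⟩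
      visits (pad W x) % q ∎
      where open ≡-Reasoning

    separates : ∀ {n} (x y : Vec Bool n) → ¬ q ∣ ∣ visits (pad W x) - visits (pad W y) ∣ →
                Σ[ M ∈ DFA ] (DFA.∣Q∣ M ≡ r * (2 * q) × Accepts M x × ¬ Accepts M y)
    separates x y q∤ = machine (count (final x)) , refl , refl ,
      λ eq → q∤ (%-≡⇒∣ _ _ q (trans (sym (count-final x)) (trans (sym eq) (count-final y))))

  -- `K` bounds the bit length of `D`, hence r, and `J` that of the counts, hence q. Passing to a
  -- multiple of the non-divisor above `W` doubles the first factor of the state bound.
  separation-by-weight : ∀ {n} W w → 1 ≤ W → (x y : Vec Bool n) (g : ℤ → ℤ) → (∀ r a → + r ℤ.∣ g a ℤ.- g (a ℤ.+ + r)) →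
    ∀ K J → let D = Σ< (W + n) (λ s → bits-difference (Pattern.occurs W w (pad W x) s) (Pattern.occurs W w (pad W y) s) (g (+ s))) in
    ℤ.∣ D ∣ ≢ 0 → ℤ.∣ D ∣ < 2 ^ K → W < suc (K + K) → W + n < 2 ^ J →
    Σ[ M ∈ DFA ] (DFA.∣Q∣ M ≤ (suc (K + K) + suc (K + K)) * (2 * suc (J + J)) × Accepts M x × ¬ Accepts M y)
  separation-by-weight {n} W w 1≤W x y g periodic K J D≢0 D< W<R short
    with nonDivisor D≢0 K D<
  ... | r₀ , 1≤r₀ , r₀≤R , r₀∤D with multiple-between r₀ (suc (K + K)) 1≤r₀ r₀≤R
  ...   | r@(suc _) , r₀∣r , R<r , r≤2R
          with residueSums-differ r g (periodic r) (W + n) (Pattern.occurs W w (pad W x)) (Pattern.occurs W w (pad W y)) (r₀∤D ∘ ∣-trans r₀∣r)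
  ...     | c , c<r , S≢ with nonDivisor (S≢ ∘ ∣m-n∣≡0⇒m≡n) J (≤-<-trans (≤-trans (∣m-n∣≤m⊔n (S x) (S y)) (⊔-lub (S≤ x) (S≤ y))) short)
    where
    S : Vec Bool n → ℕ
    S x = residueSum r c (W + n) (bit ∘ Pattern.occurs W w (pad W x))
    S≤ : ∀ x → S x ≤ W + n
    S≤ x = residueSum-≤ r c (W + n) (Pattern.occurs W w (pad W x))
  ...       | q@(suc _) , _ , q≤ , q∤
              with Machine.separates W w 1≤W r q (<-trans W<R R<r) c<r x y
                     (q∤ ∘ subst₂ (λ i j → q ∣ ∣ residueSum r c i (bit ∘ Pattern.occurs W w (pad W x)) - residueSum r c j (bit ∘ Pattern.occurs W w (pad W y)) ∣) (length-pad W x) (length-pad W y))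
  ...         | M , ∣Q∣≡ , acc , rej = M , ≤-trans (≤-reflexive ∣Q∣≡) (*-mono-≤ r≤2R (*-monoʳ-≤ 2 q≤)) , acc , rej

  module Construction (m n : ℕ) (n< : n < 8 ^ suc m) (e : ℕ) (e-large : 6 * m + 12 < 2 ^ e) where

    -- 2 ^ a = 8 ^ (m + 2) leaves room for the padding. With `L = 2 ^ m`, `k = m + 3` gives 4 ^ k ·
    -- 2L = 2 ^ (a + 1). The bound 6m + 12 on 2 ^ e is 2a, since `excess` compares 2 ^ (2 ^ e) with
    -- a product of two numbers up to 2 ^ a. The degree is 2 ^ i.
    a k L W i : ℕ
    a = 3 * m + 6
    k = m + 3
    L = 2 ^ m
    W = L + L
    i = k + e

    8^≡ : ∀ j → 8 ^ j ≡ 2 ^ (3 * j)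
    8^≡ j = ^-*-assoc 2 3 j

    length≤ : W + n ≤ 2 ^ a
    length≤ = begin
      L + L + n                         ≤⟨ +-mono-≤ (+-mono-≤ L≤ L≤) (<⇒≤ n<) ⟩
      8 ^ suc m + 8 ^ suc m + 8 ^ suc m ≤⟨ m≤m+n _ (5 * 8 ^ suc m) ⟩
      8 ^ suc m + 8 ^ suc m + 8 ^ suc m + 5 * 8 ^ suc m ≡⟨ l (8 ^ suc m) ⟩
      8 ^ suc (suc m)                   ≡⟨ 8^≡ (suc (suc m)) ⟩
      2 ^ (3 * suc (suc m))             ≡⟨ cong (2 ^_) (l′ m) ⟩
      2 ^ a                             ∎
      where
      open ≤-Reasoning
      L≤ : L ≤ 8 ^ suc m
      L≤ = ≤-trans (^-monoʳ-≤ 2 (≤-trans (n≤1+n m) (m≤n*m (suc m) 3))) (≤-reflexive (sym (8^≡ (suc m))))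
      l : ∀ x → x + x + x + 5 * x ≡ 8 * x
      l = solve-∀
      l′ : ∀ m → 3 * suc (suc m) ≡ 3 * m + 6
      l′ = solve-∀

    scale : 2 ^ a ≤ 4 ^ k * (2 * L)
    scale = begin
      2 ^ a                     ≤⟨ ^-monoʳ-≤ 2 (n≤1+n a) ⟩
      2 ^ suc a                 ≡⟨ cong (2 ^_) (l m) ⟩
      2 ^ (2 * k + suc m)       ≡⟨ ^-distribˡ-+-* 2 (2 * k) (suc m) ⟩
      2 ^ (2 * k) * (2 * L)     ≡⟨ cong (_* (2 * L)) (^-*-assoc 2 2 k) ⟨
      4 ^ k * (2 * L)           ∎
      where
      open ≤-Reasoning
      l : ∀ m → suc (3 * m + 6) ≡ 2 * (m + 3) + suc m
      l = solve-∀

    1≤L : 1 ≤ L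
    1≤L = m^n>0 2 m

    -- `D` has at most 2 ^ a terms. The quantities entering the weight are at most 2 ^ (a + 2), so
    -- by `∣weight∣≤` each term is at most 2 ^ ((a + 3) 2 ^ i). The `suc` makes the bound strict.
    K R : ℕ
    K = suc a + (a + 3) * 2 ^ i
    R = suc (K + K)

    W<R : W < R
    W<R = s≤s (+-mono-≤ L≤K L≤K)
      where
      L≤K : L ≤ K
      L≤K = begin
        2 ^ m               ≤⟨ ^-monoʳ-≤ 2 (≤-trans (m≤m+n m 3) (m≤m+n k e)) ⟩
        2 ^ i               ≤⟨ m≤n*m (2 ^ i) (a + 3) {{≢-nonZero (λ a+3≡0 → 1+n≢0 (trans (sym (+-suc a 2)) a+3≡0))}} ⟩
        (a + 3) * 2 ^ i     ≤⟨ m≤n+m _ (suc a) ⟩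
        K                   ∎
        where open ≤-Reasoning

    separating-DFA : (x y : Vec Bool n) → x ≢ y →
      Σ[ M ∈ DFA ] (DFA.∣Q∣ M ≤ (R + R) * (2 * suc (suc a + suc a)) × Accepts M x × ¬ Accepts M y)
    separating-DFA x y x≢y with pad-distinguish L x y x≢y
    ... | t , t<n , dist = result
      where
      open Distinguished dist
      open Pattern W w using (occurs)
      X = pad W x
      Y = pad W y

      N : ℕ
      N = W + n ∸ suc t

      t+1+N : t + suc N ≡ W + n
      t+1+N = trans (+-suc t N) (m+[n∸m]≡n (≤-trans t<n (m≤n+m n W)))

      N≤ : N ≤ 2 ^ a
      N≤ = ≤-trans (m∸n≤m (W + n) (suc t)) length≤

      excess : N * 2 ^ a < 2 ^ (2 ^ e)
      excess = begin-strict
        N * 2 ^ a           ≤⟨ *-monoˡ-≤ (2 ^ a) N≤ ⟩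
        2 ^ a * 2 ^ a       ≡⟨ ^-distribˡ-+-* 2 a a ⟨
        2 ^ (a + a)         <⟨ ^-monoʳ-< 2 ≤-refl (subst (_< 2 ^ e) (l m) e-large) ⟩
        2 ^ (2 ^ e)         ∎
        where
        open ≤-Reasoning
        l : ∀ m → 6 * m + 12 ≡ (3 * m + 6) + (3 * m + 6)
        l = solve-∀

      open Weighted a k e L t N 1≤L N≤ scale excess

      g : ℤ → ℤ
      g = weight i v (+ centre)

      D : ℤ
      D = Σ< (W + n) (λ s → bits-difference (occurs X s) (occurs Y s) (g (+ s)))

      D≢0 : ℤ.∣ D ∣ ≢ 0
      D≢0 ∣D∣≡0 = weighted-nonZero (occurs X) (occurs Y) separatedˡ separatedʳ before here
        (trans (cong (λ j → Σ< j (λ s → bits-difference (occurs X s) (occurs Y s) (g (+ s)))) t+1+N) (ℤ.∣i∣≡0⇒i≡0 ∣D∣≡0))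

      2^[a+2] : 2 ^ (a + 2) ≡ 2 ^ a * 4
      2^[a+2] = ^-distribˡ-+-* 2 a 2

      centre≤ : centre ≤ 2 ^ (a + 2)
      centre≤ = begin
        2 ^ a + 2 * (L + t)       ≤⟨ +-monoʳ-≤ (2 ^ a) (*-monoʳ-≤ 2 (≤-trans (+-mono-≤ (m≤m+n L L) (<⇒≤ t<n)) length≤)) ⟩
        2 ^ a + 2 * 2 ^ a         ≤⟨ m≤m+n _ (2 ^ a) ⟩
        2 ^ a + 2 * 2 ^ a + 2 ^ a ≡⟨ l (2 ^ a) ⟩
        2 ^ a * 4                 ≡⟨ 2^[a+2] ⟨
        2 ^ (a + 2)               ∎
        where
        open ≤-Reasoning
        l : ∀ x → x + 2 * x + x ≡ x * 4
        l = solve-∀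

      term≤ : ∀ s → s < W + n → ℤ.∣ bits-difference (occurs X s) (occurs Y s) (g (+ s)) ∣ ≤ 2 ^ (suc (a + 2) * 2 ^ i)
      term≤ s s< = ≤-trans (∣difference∣≤ (occurs X s) (occurs Y s) (g (+ s)))
        (∣weight∣≤ i a (a + 2) centre s (^-monoʳ-≤ 2 (m≤m+n a 2)) centre≤ (begin
          2 * s             ≤⟨ *-monoʳ-≤ 2 (≤-trans (<⇒≤ s<) length≤) ⟩
          2 * 2 ^ a         ≤⟨ *-monoˡ-≤ (2 ^ a) {2} {4} (s≤s (s≤s z≤n)) ⟩
          4 * 2 ^ a         ≡⟨ *-comm 4 (2 ^ a) ⟩
          2 ^ a * 4         ≡⟨ 2^[a+2] ⟨
          2 ^ (a + 2)       ∎))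
        where open ≤-Reasoning

      D< : ℤ.∣ D ∣ < 2 ^ K
      D< = begin-strict
        ℤ.∣ D ∣                                   ≤⟨ ∣Σ<∣≤ (W + n) _ _ term≤ ⟩
        (W + n) * 2 ^ (suc (a + 2) * 2 ^ i)       ≤⟨ *-monoˡ-≤ (2 ^ (suc (a + 2) * 2 ^ i)) length≤ ⟩
        2 ^ a * 2 ^ (suc (a + 2) * 2 ^ i)         ≡⟨ ^-distribˡ-+-* 2 a _ ⟨
        2 ^ (a + suc (a + 2) * 2 ^ i)             <⟨ ^-monoʳ-< 2 ≤-refl (≤-reflexive (cong (λ x → suc a + x * 2 ^ i) (sym (+-suc a 2)))) ⟩
        2 ^ K                                     ∎
        where open ≤-Reasoning

      result : Σ[ M ∈ DFA ] (DFA.∣Q∣ M ≤ (R + R) * (2 * suc (suc a + suc a)) × Accepts M x × ¬ Accepts M y)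
      result = separation-by-weight W w (≤-trans 1≤L (m≤m+n L L)) x y g (λ r → weight-periodic i v (+ centre) (+ r))
        K (suc a) D≢0 D< W<R (≤-<-trans length≤ (^-monoʳ-< 2 ≤-refl {a} ≤-refl))

  -- x stands for 2 ^ m and p for the degree of the weight polynomial.
  size-bound : ∀ m x p → p ≤ x * 8 * (2 * (6 * m + 12)) → 1 ≤ p →
    let a = 3 * m + 6
        K = suc a + (a + 3) * p
    in (suc (K + K) + suc (K + K)) * (2 * suc (suc a + suc a)) ≤ x * suc m ^ 7 * 380160
  size-bound m x p p≤ 1≤p = begin
    (suc (K + K) + suc (K + K)) * (2 * suc (suc a + suc a)) ≤⟨ *-mono-≤ (+-mono-≤ R≤ R≤) (*-monoʳ-≤ 2 q≤) ⟩
    (33 * μ * (192 * (x * μ)) + 33 * μ * (192 * (x * μ))) * (2 * (15 * μ)) ≡⟨ l μ x 33 192 15 ⟩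
    -- One factor `μ` comes from the bit length `a`, one from the degree `p` and one from the
    -- modulus q; the exponent is then relaxed to the 7 of the statement.
    x * μ ^ 3 * (4 * 33 * 192 * 15)                  ≤⟨ *-monoˡ-≤ (4 * 33 * 192 * 15) (*-monoʳ-≤ x (^-monoʳ-≤ μ {3} {7} (s≤s (s≤s (s≤s z≤n))))) ⟩
    x * μ ^ 7 * (4 * 33 * 192 * 15)                  ∎
    where
    open ≤-Reasoning
    μ = suc m
    a = 3 * m + 6
    K = suc a + (a + 3) * p

    l : ∀ x p c₁ c₂ c₃ → (c₁ * x * (c₂ * (p * x)) + c₁ * x * (c₂ * (p * x))) * (2 * (c₃ * x)) ≡ p * (x * (x * (x * 1))) * (4 * c₁ * c₂ * c₃)
    l = solve-∀

    p≤′ : p ≤ 192 * (x * μ)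
    p≤′ = begin
      p                                       ≤⟨ p≤ ⟩
      x * 8 * (2 * (6 * m + 12))              ≤⟨ *-monoʳ-≤ (x * 8) (*-monoʳ-≤ 2 (m≤m+n (6 * m + 12) (6 * m))) ⟩
      x * 8 * (2 * (6 * m + 12 + 6 * m))      ≡⟨ l₀ x m ⟩
      192 * (x * μ)                           ∎
      where
      l₀ : ∀ x m → x * 8 * (2 * (6 * m + 12 + 6 * m)) ≡ 192 * (x * suc m)
      l₀ = solve-∀

    R≤ : suc (K + K) ≤ 33 * μ * (192 * (x * μ))
    R≤ = begin
      suc (K + K)                                       ≡⟨ l₁ a p ⟩
      2 * a + 3 + (2 * a + 6) * p                       ≤⟨ +-monoˡ-≤ _ (m≤m*n (2 * a + 3) p {{>-nonZero 1≤p}}) ⟩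
      (2 * a + 3) * p + (2 * a + 6) * p                 ≤⟨ m≤m+n _ (21 * m * p) ⟩
      (2 * a + 3) * p + (2 * a + 6) * p + 21 * m * p    ≡⟨ l₂ m p ⟩
      33 * μ * p                                        ≤⟨ *-monoʳ-≤ (33 * μ) p≤′ ⟩
      33 * μ * (192 * (x * μ))                          ∎
      where
      l₁ : ∀ a x → suc ((suc a + (a + 3) * x) + (suc a + (a + 3) * x)) ≡ 2 * a + 3 + (2 * a + 6) * x
      l₁ = solve-∀
      l₂ : ∀ m x → (2 * (3 * m + 6) + 3) * x + (2 * (3 * m + 6) + 6) * x + 21 * m * x ≡ 33 * suc m * x
      l₂ = solve-∀

    q≤ : suc (suc a + suc a) ≤ 15 * μ
    q≤ = ≤-trans (m≤m+n _ (9 * m)) (≤-reflexive (l₃ m))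
      where
      l₃ : ∀ m → suc (suc (3 * m + 6) + suc (3 * m + 6)) + 9 * m ≡ 15 * suc m
      l₃ = solve-∀

  separation : ∀ m n → n < 8 ^ suc m → (x y : Vec Bool n) → x ≢ y →
    Σ[ M ∈ DFA ] (DFA.∣Q∣ M ≤ 2 ^ m * suc m ^ 7 * 380160 × Accepts M x × ¬ Accepts M y)
  separation m n n< x y x≢y =
    -- `suc e` is the least exponent with 6m + 12 < 2 ^ suc e, so 2 ^ suc e is at most twice that
    -- number and the degree stays of order 2 ^ m · m.
    let e , low , up = floor-log 2 ≤-refl (6 * m + 12) (≤-trans (s≤s z≤n) (m≤n+m 12 (6 * m)))
        M , ∣Q∣≤ , acc , rej = Construction.separating-DFA m n n< (suc e) up x y x≢y
    in M , ≤-trans ∣Q∣≤ (size-bound m (2 ^ m) (2 ^ (m + 3 + suc e)) (degree≤ e low) (m^n>0 2 (m + 3 + suc e))) , acc , rej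
    where
    degree≤ : ∀ e → 2 ^ e ≤ 6 * m + 12 → 2 ^ (m + 3 + suc e) ≤ 2 ^ m * 8 * (2 * (6 * m + 12))
    degree≤ e low = begin
      2 ^ (m + 3 + suc e)             ≡⟨ ^-distribˡ-+-* 2 (m + 3) (suc e) ⟩
      2 ^ (m + 3) * (2 * 2 ^ e)       ≡⟨ cong (_* (2 * 2 ^ e)) (^-distribˡ-+-* 2 m 3) ⟩
      2 ^ m * 8 * (2 * 2 ^ e)         ≤⟨ *-monoʳ-≤ (2 ^ m * 8) (*-monoʳ-≤ 2 low) ⟩
      2 ^ m * 8 * (2 * (6 * m + 12))  ∎
      where open ≤-Reasoning

-- Rational lower bounds for cube roots, logarithms and their products.

module RealBounds where

  open import Defs
  open import Algebra.Bundles using (CommutativeRing)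
  open import Data.Integer as ℤ using (ℤ)
  import Data.Integer.Properties as ℤ
  open import Data.Nat as ℕ using (ℕ; zero; suc; _!)
  import Data.Nat.Properties as ℕ
  open import Data.Rational
  open import Data.Rational.Properties
  import Data.Rational.Unnormalised as ℚᵘ
  import Data.Rational.Unnormalised.Properties as ℚᵘ
  open import Data.Rational.Solver
  open import Data.Product using (_×_; _,_; proj₁; proj₂)
  open import Data.Sum using (inj₁; inj₂)
  open import Relation.Binary.PropositionalEquality
  open import Relation.Unary using (_∈_)
  open import Algebra.Properties.Semiring.Exp (CommutativeRing.semiring +-*-commutativeRing) using (_^_)
  open ℝ≥0


  ι : ℕ → ℚ
  ι k = ℤ.+ k / 1

  toℚᵘ-ι : ∀ k → toℚᵘ (ι k) ℚᵘ.≃ ℚᵘ.mkℚᵘ (ℤ.+ k) 0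
  toℚᵘ-ι k = toℚᵘ-fromℚᵘ (ℚᵘ.mkℚᵘ (ℤ.+ k) 0)

  ι-* : ∀ a b → ι (a ℕ.* b) ≡ ι a * ι b
  ι-* a b = toℚᵘ-injective (begin
    toℚᵘ (ι (a ℕ.* b))                            ≈⟨ toℚᵘ-ι (a ℕ.* b) ⟩
    ℚᵘ.mkℚᵘ (ℤ.+ (a ℕ.* b)) 0                       ≈⟨ ℚᵘ.*≡* (cong (ℤ._* ℤ.+ 1) (ℤ.pos-* a b)) ⟩
    ℚᵘ.mkℚᵘ (ℤ.+ a) 0 ℚᵘ.* ℚᵘ.mkℚᵘ (ℤ.+ b) 0          ≈⟨ ℚᵘ.*-cong (toℚᵘ-ι a) (toℚᵘ-ι b) ⟨
    toℚᵘ (ι a) ℚᵘ.* toℚᵘ (ι b)                    ≈⟨ toℚᵘ-homo-* (ι a) (ι b) ⟨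
    toℚᵘ (ι a * ι b)                              ∎)
    where open ℚᵘ.≃-Reasoning

  ι-+ : ∀ a b → ι (a ℕ.+ b) ≡ ι a + ι b
  ι-+ a b = toℚᵘ-injective (begin
    toℚᵘ (ι (a ℕ.+ b))                            ≈⟨ toℚᵘ-ι (a ℕ.+ b) ⟩
    ℚᵘ.mkℚᵘ (ℤ.+ (a ℕ.+ b)) 0                       ≈⟨ ℚᵘ.*≡* (cong (ℤ._* ℤ.+ 1) (trans (ℤ.pos-+ a b) (sym (cong₂ ℤ._+_ (ℤ.*-identityʳ (ℤ.+ a)) (ℤ.*-identityʳ (ℤ.+ b)))))) ⟩
    ℚᵘ.mkℚᵘ (ℤ.+ a) 0 ℚᵘ.+ ℚᵘ.mkℚᵘ (ℤ.+ b) 0          ≈⟨ ℚᵘ.+-cong (toℚᵘ-ι a) (toℚᵘ-ι b) ⟨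
    toℚᵘ (ι a) ℚᵘ.+ toℚᵘ (ι b)                    ≈⟨ toℚᵘ-homo-+ (ι a) (ι b) ⟨
    toℚᵘ (ι a + ι b)                              ∎)
    where open ℚᵘ.≃-Reasoning

  ι-mono-≤ : ∀ {a b} → a ℕ.≤ b → ι a ≤ ι b
  ι-mono-≤ {a} {b} a≤b = toℚᵘ-cancel-≤ (ℚᵘ.≤-respˡ-≃ (ℚᵘ.≃-sym (toℚᵘ-ι a)) (ℚᵘ.≤-respʳ-≃ (ℚᵘ.≃-sym (toℚᵘ-ι b))
    (ℚᵘ.*≤* (ℤ.*-monoʳ-≤-nonNeg (ℤ.+ 1) (ℤ.+≤+ a≤b)))))

  ι-mono-< : ∀ {a b} → a ℕ.< b → ι a < ι b
  ι-mono-< {a} {b} a<b = toℚᵘ-cancel-< (ℚᵘ.<-respˡ-≃ (ℚᵘ.≃-sym (toℚᵘ-ι a)) (ℚᵘ.<-respʳ-≃ (ℚᵘ.≃-sym (toℚᵘ-ι b))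
    (ℚᵘ.*<* (ℤ.*-monoʳ-<-pos (ℤ.+ 1) (ℤ.+<+ a<b)))))

  0≤ι : ∀ k → 0ℚ ≤ ι k
  0≤ι k = ι-mono-≤ {0} {k} ℕ.z≤n

  ι-^ : ∀ k j → ι k ^ j ≡ ι (k ℕ.^ j)
  ι-^ k zero    = refl
  ι-^ k (suc j) = trans (cong (ι k *_) (ι-^ k j)) (sym (ι-* k (k ℕ.^ j)))

  *-nonNeg : ∀ {p q} → 0ℚ ≤ p → 0ℚ ≤ q → 0ℚ ≤ p * q
  *-nonNeg {p} {q} 0≤p 0≤q = subst (_≤ p * q) (*-zeroʳ p) (*-monoˡ-≤-nonNeg p {{nonNegative 0≤p}} 0≤q)

  inv : (d : ℕ) .{{_ : ℕ.NonZero d}} → ℚ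
  inv d = ℤ.+ 1 / d

  ι-inv : ∀ d .{{_ : ℕ.NonZero d}} → ι d * inv d ≡ 1ℚ
  ι-inv d@(suc d-1) = toℚᵘ-injective (begin
    toℚᵘ (ι d * inv d)                            ≈⟨ toℚᵘ-homo-* (ι d) (inv d) ⟩
    toℚᵘ (ι d) ℚᵘ.* toℚᵘ (inv d)                  ≈⟨ ℚᵘ.*-cong (toℚᵘ-ι d) (toℚᵘ-fromℚᵘ (ℚᵘ.mkℚᵘ (ℤ.+ 1) d-1)) ⟩
    ℚᵘ.mkℚᵘ (ℤ.+ d) 0 ℚᵘ.* ℚᵘ.mkℚᵘ (ℤ.+ 1) d-1        ≈⟨ ℚᵘ.*≡* (trans (cong (ℤ._* ℤ.+ 1) (ℤ.*-identityʳ (ℤ.+ d))) (trans (ℤ.*-identityʳ (ℤ.+ d)) (sym (trans (ℤ.*-identityˡ _) (cong ℤ.+_ (ℕ.*-identityˡ d)))))) ⟩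
    ℚᵘ.1ℚᵘ                                        ∎)
    where open ℚᵘ.≃-Reasoning

  0≤inv : ∀ d .{{_ : ℕ.NonZero d}} → 0ℚ ≤ inv d
  0≤inv d = nonNegative⁻¹ (inv d) {{normalize-nonNeg 1 d}}

  inv! : ℕ → ℚ
  inv! j = inv (j !) {{j ℕ.!≢0}}

  inv!-suc : ∀ j → inv! j ≡ ι (suc j) * inv! (suc j)
  inv!-suc j = begin
    inv! j                                                ≡⟨ *-identityʳ (inv! j) ⟨
    inv! j * 1ℚ                                           ≡⟨ cong (inv! j *_) (ι-inv (suc j !) {{suc j ℕ.!≢0}}) ⟨
    inv! j * (ι (suc j !) * inv! (suc j))                 ≡⟨ cong (λ x → inv! j * (x * inv! (suc j))) (ι-* (suc j) (j !)) ⟩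
    inv! j * (ι (suc j) * ι (j !) * inv! (suc j))         ≡⟨ l (inv! j) (ι (suc j)) (ι (j !)) (inv! (suc j)) ⟩
    ι (j !) * inv! j * (ι (suc j) * inv! (suc j))         ≡⟨ cong (_* (ι (suc j) * inv! (suc j))) (ι-inv (j !) {{j ℕ.!≢0}}) ⟩
    1ℚ * (ι (suc j) * inv! (suc j))                       ≡⟨ *-identityˡ _ ⟩
    ι (suc j) * inv! (suc j)                              ∎
    where
    open ≡-Reasoning
    l : ∀ a b c d → a * (b * c * d) ≡ c * a * (b * d)
    l = solve 4 (λ a b c d → a :* (b :* c :* d) := c :* a :* (b :* d)) refl
      where open +-*-Solver

  coefficient : ℕ → ℚ
  coefficient j = ½ ^ j * inv! j

  0≤½^ : ∀ j → 0ℚ ≤ ½ ^ j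
  0≤½^ zero    = nonNegative⁻¹ 1ℚ
  0≤½^ (suc j) = *-nonNeg (nonNegative⁻¹ ½) (0≤½^ j)

  0≤coefficient : ∀ j → 0ℚ ≤ coefficient j
  0≤coefficient j = *-nonNeg (0≤½^ j) (0≤inv (j !) {{j ℕ.!≢0}})

  coefficient-suc : ∀ j → ½ * coefficient j ≡ ι (suc j) * coefficient (suc j)
  coefficient-suc j = trans (cong (λ x → ½ * (½ ^ j * x)) (inv!-suc j)) (l ½ (½ ^ j) (ι (suc j)) (inv! (suc j)))
    where
    l : ∀ a b c d → a * (b * (c * d)) ≡ c * (a * b * d)
    l = solve 4 (λ a b c d → a :* (b :* (c :* d)) := c :* (a :* b :* d)) refl
      where open +-*-Solver

  ^-distrib-* : ∀ p q j → (p * q) ^ j ≡ p ^ j * q ^ j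
  ^-distrib-* p q zero    = refl
  ^-distrib-* p q (suc j) = trans (cong (p * q *_) (^-distrib-* p q j)) (l p q (p ^ j) (q ^ j))
    where
    l : ∀ p q a b → p * q * (a * b) ≡ p * a * (q * b)
    l = solve 4 (λ p q a b → p :* q :* (a :* b) := p :* a :* (q :* b)) refl
      where open +-*-Solver

  -- The j-th term of the series of exp (k / 2), with the power of `k` kept in ℕ so that
  -- `power-step` applies to it.
  term : ℕ → ℕ → ℚ
  term k j = ι (k ℕ.^ j) * coefficient j

  expSum-suc : ∀ k N → expSum (ι k * ½) (suc N) ≡ expSum (ι k * ½) N + term k (suc N)
  expSum-suc k N = cong (expSum (ι k * ½) N +_)
    (trans (cong (_* inv! (suc N)) (trans (^-distrib-* (ι k) ½ (suc N)) (cong (_* ½ ^ suc N) (ι-^ k (suc N)))))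
      (*-assoc (ι (k ℕ.^ suc N)) (½ ^ suc N) (inv! (suc N))))

  -- The mean value bound for x ^ (j + 1) between k and k + 1.
  power-step : ∀ k j → suc k ℕ.^ suc j ℕ.≤ k ℕ.^ suc j ℕ.+ suc j ℕ.* suc k ℕ.^ j
  power-step k zero    = ℕ.≤-reflexive (l k)
    where
    open import Data.Nat.Tactic.RingSolver
    l : ∀ k → suc k ℕ.* 1 ≡ k ℕ.* 1 ℕ.+ 1 ℕ.* 1
    l = solve-∀
  power-step k (suc j) = begin
    suc k ℕ.* suc k ℕ.^ suc j                       ≤⟨ ℕ.*-monoʳ-≤ (suc k) (power-step k j) ⟩
    suc k ℕ.* (x ℕ.+ suc j ℕ.* suc k ℕ.^ j)         ≡⟨ l k x j (suc k ℕ.^ j) ⟩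
    k ℕ.* x ℕ.+ (x ℕ.+ suc j ℕ.* suc k ℕ.^ suc j)   ≤⟨ ℕ.+-monoʳ-≤ (k ℕ.* x) (ℕ.+-monoˡ-≤ _ (ℕ.^-monoˡ-≤ (suc j) (ℕ.n≤1+n k))) ⟩
    k ℕ.* x ℕ.+ suc (suc j) ℕ.* suc k ℕ.^ suc j     ∎
    where
    open ℕ.≤-Reasoning
    open import Data.Nat.Tactic.RingSolver
    x = k ℕ.^ suc j
    l : ∀ k x j y → suc k ℕ.* (x ℕ.+ suc j ℕ.* y) ≡ k ℕ.* x ℕ.+ (x ℕ.+ suc j ℕ.* (suc k ℕ.* y))
    l = solve-∀

  term-step : ∀ k j → term (suc k) (suc j) ≤ term k (suc j) + ½ * term (suc k) j
  term-step k j = begin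
    ι (suc k ℕ.^ suc j) * c                               ≤⟨ *-monoʳ-≤-nonNeg c {{nonNegative (0≤coefficient (suc j))}} (ι-mono-≤ (power-step k j)) ⟩
    ι (k ℕ.^ suc j ℕ.+ suc j ℕ.* suc k ℕ.^ j) * c         ≡⟨ cong (_* c) (trans (ι-+ (k ℕ.^ suc j) _) (cong (ι (k ℕ.^ suc j) +_) (ι-* (suc j) (suc k ℕ.^ j)))) ⟩
    (ι (k ℕ.^ suc j) + ι (suc j) * y) * c                 ≡⟨ l (ι (k ℕ.^ suc j)) (ι (suc j)) y c ⟩
    term k (suc j) + y * (ι (suc j) * c)                  ≡⟨ cong (λ x → term k (suc j) + y * x) (coefficient-suc j) ⟨
    term k (suc j) + y * (½ * coefficient j)              ≡⟨ cong (term k (suc j) +_) (l′ y ½ (coefficient j)) ⟩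
    term k (suc j) + ½ * term (suc k) j                   ∎
    where
    open ≤-Reasoning
    c = coefficient (suc j)
    y = ι (suc k ℕ.^ j)
    l : ∀ a b y c → (a + b * y) * c ≡ a * c + y * (b * c)
    l = solve 4 (λ a b y c → (a :+ b :* y) :* c := a :* c :+ y :* (b :* c)) refl
      where open +-*-Solver
    l′ : ∀ y h c → y * (h * c) ≡ h * (y * c)
    l′ = solve 3 (λ y h c → y :* (h :* c) := h :* (y :* c)) refl
      where open +-*-Solver

  expSum-step : ∀ k N → expSum (ι (suc k) * ½) (suc N) ≤ expSum (ι k * ½) (suc N) + ½ * expSum (ι (suc k) * ½) N
  expSum-step k zero = begin
    expSum (ι (suc k) * ½) 1                 ≡⟨ expSum-suc (suc k) 0 ⟩
    1ℚ + term (suc k) 1                      ≤⟨ +-monoʳ-≤ 1ℚ (term-step k 0) ⟩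
    1ℚ + (term k 1 + ½ * term (suc k) 0)     ≡⟨ +-assoc 1ℚ (term k 1) _ ⟨
    1ℚ + term k 1 + ½ * 1ℚ                   ≡⟨ cong (_+ ½ * 1ℚ) (expSum-suc k 0) ⟨
    expSum (ι k * ½) 1 + ½ * 1ℚ              ∎
    where open ≤-Reasoning
  expSum-step k (suc N) = begin
    expSum (ι (suc k) * ½) (2 ℕ.+ N)         ≡⟨ expSum-suc (suc k) (suc N) ⟩
    expSum (ι (suc k) * ½) (suc N) + term (suc k) (2 ℕ.+ N)
      ≤⟨ +-mono-≤ (expSum-step k N) (term-step k (suc N)) ⟩
    (a + ½ * b) + (c + ½ * d)                ≡⟨ l a ½ b c d ⟩
    (a + c) + ½ * (b + d)                    ≡⟨ cong₂ (λ x y → x + ½ * y) (expSum-suc k (suc N)) (expSum-suc (suc k) N) ⟨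
    expSum (ι k * ½) (2 ℕ.+ N) + ½ * expSum (ι (suc k) * ½) (suc N) ∎
    where
    open ≤-Reasoning
    a = expSum (ι k * ½) (suc N)
    b = expSum (ι (suc k) * ½) N
    c = term k (2 ℕ.+ N)
    d = term (suc k) (suc N)
    l : ∀ a h b c d → (a + h * b) + (c + h * d) ≡ (a + c) + h * (b + d)
    l = solve 5 (λ a h b c d → (a :+ h :* b) :+ (c :+ h :* d) := (a :+ c) :+ h :* (b :+ d)) refl
      where open +-*-Solver

  -- Termwise, exp (k / 2) is bounded by the binomial series of
  -- (1 - 1/2)⁻ᵏ; expSum-step is the recurrence of that series.
  expSum-half≤2^ : ∀ k N → expSum (ι k * ½) N ≤ ι (2 ℕ.^ k)
  expSum-half≤2^ k       zero    = ι-mono-≤ (ℕ.m^n>0 2 k)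
  expSum-half≤2^ zero    (suc N) = ≤-trans (≤-reflexive (begin
      expSum (ι 0 * ½) (suc N)         ≡⟨ expSum-suc 0 N ⟩
      expSum (ι 0 * ½) N + term 0 (suc N) ≡⟨ cong (expSum (ι 0 * ½) N +_) (*-zeroˡ (coefficient (suc N))) ⟩
      expSum (ι 0 * ½) N + 0ℚ          ≡⟨ +-identityʳ _ ⟩
      expSum (ι 0 * ½) N               ∎))
    (expSum-half≤2^ zero N)
    where open ≡-Reasoning
  expSum-half≤2^ (suc k) (suc N) = begin
    expSum (ι (suc k) * ½) (suc N)                            ≤⟨ expSum-step k N ⟩
    expSum (ι k * ½) (suc N) + ½ * expSum (ι (suc k) * ½) N   ≤⟨ +-mono-≤ (expSum-half≤2^ k (suc N)) (*-monoˡ-≤-nonNeg ½ (expSum-half≤2^ (suc k) N)) ⟩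
    x + ½ * ι (2 ℕ.* 2 ℕ.^ k)                                 ≡⟨ cong (λ y → x + ½ * y) (ι-* 2 (2 ℕ.^ k)) ⟩
    x + ½ * (ι 2 * x)                                         ≡⟨ cong (x +_) (*-assoc ½ (ι 2) x) ⟨
    x + 1ℚ * x                                                ≡⟨ cong (_+ 1ℚ * x) (*-identityˡ x) ⟨
    1ℚ * x + 1ℚ * x                                           ≡⟨ *-distribʳ-+ x 1ℚ 1ℚ ⟨
    ι 2 * x                                                   ≡⟨ ι-* 2 (2 ℕ.^ k) ⟨
    ι (2 ℕ.^ suc k)                                           ∎
    where
    open ≤-Reasoning
    x = ι (2 ℕ.^ k)

  -- A product cut contains only what lies strictly below some product, so both factors are first
  -- moved up by roundedness. Since q′ > 0, the product increases strictly even when p = 0.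
  *ʳ-below : ∀ {x y p q} → 0ℚ ≤ p → p ∈ Below x → 0ℚ ≤ q → q ∈ Below y → p * q ∈ Below (x *ʳ y)
  *ʳ-below {x} {y} {p} {q} 0≤p p<x 0≤q q<y =
    let p′ , p<p′ , p′<x = rounded x p<x
        q′ , q<q′ , q′<y = rounded y q<y
        0≤p′ = ≤-trans 0≤p (<⇒≤ p<p′)
        0<q′ = ≤-<-trans 0≤q q<q′
    in inj₂ (p′ * q′ , (p′ , q′ , 0≤p′ , p′<x , <⇒≤ 0<q′ , q′<y , refl) ,
         ≤-<-trans (*-monoˡ-≤-nonNeg p {{nonNegative 0≤p}} (<⇒≤ q<q′)) (*-monoˡ-<-pos q′ {{positive 0<q′}} p<p′))

  -- The factor `½` stems from the empty product: 1 is not strictly below `fromℕ 1`, but `½` is.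
  ^ʳ-below : ∀ {x p} k → 0ℚ ≤ p → p ∈ Below x → p ^ k * ½ ∈ Below (x ^ʳ k) × 0ℚ ≤ p ^ k * ½
  ^ʳ-below zero    0≤p p<x = inj₂ (1ℚ , refl , *<* (ℤ.+<+ (ℕ.s≤s (ℕ.s≤s ℕ.z≤n)))) , *≤* (ℤ.+≤+ ℕ.z≤n)
  ^ʳ-below {x} {p} (suc k) 0≤p p<x =
    let below , 0≤ = ^ʳ-below k 0≤p p<x in
    subst (_∈ Below (x ^ʳ suc k)) (sym (*-assoc p (p ^ k) ½)) (*ʳ-below {x} {x ^ʳ k} 0≤p p<x 0≤ below) ,
    subst (0ℚ ≤_) (sym (*-assoc p (p ^ k) ½)) (*-nonNeg 0≤p 0≤)

  fromℕ-≤ʳ : ∀ {k x p} → ι k ≤ p → p ∈ Below x → fromℕ k ≤ʳ x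
  fromℕ-≤ʳ {x = x} k≤p p<x (inj₁ q<0)             = below-0 x q<0
  fromℕ-≤ʳ {x = x} k≤p p<x (inj₂ (_ , refl , q<k)) = downward x (<-≤-trans q<k k≤p) p<x

  -- Halving turns an element of the set defining a supremum into one strictly below it, and costs
  -- only a constant factor.
  half< : ∀ {p} → 0ℚ < p → p * ½ < p
  half< {p} 0<p = subst (p * ½ <_) (*-identityʳ p) (*-monoʳ-<-pos p {{positive 0<p}} (*<* (ℤ.+<+ (ℕ.s≤s (ℕ.s≤s ℕ.z≤n)))))

  0≤ι½ : ∀ k → 0ℚ ≤ ι k * ½
  0≤ι½ k = *-nonNeg (0≤ι k) (nonNegative⁻¹ ½)

  cbrt-below : ∀ {m n} → 8 ℕ.^ m ℕ.≤ n → ι (2 ℕ.^ m) * ½ ∈ Below (cbrt n)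
  cbrt-below {m} {n} 8^m≤n = inj₂ (ι (2 ℕ.^ m) , (0≤ι (2 ℕ.^ m) , cube≤) , half< (ι-mono-< (ℕ.m^n>0 2 m)))
    where
    cube≤ : ι (2 ℕ.^ m) ^ 3 ≤ ι n
    cube≤ = ≤-trans (≤-reflexive (trans (ι-^ (2 ℕ.^ m) 3) (cong ι
      (trans (ℕ.^-*-assoc 2 m 3) (trans (cong (2 ℕ.^_) (ℕ.*-comm m 3)) (sym (ℕ.^-*-assoc 2 3 m)))))))
      (ι-mono-≤ 8^m≤n)

  -- Since exp (k / 2) ≤ 2 ^ k, the number k / 2 belongs to the set that defines `log n`; the second
  -- `½` is for strictness.
  log-below : ∀ {k n} → 1 ℕ.≤ k → 2 ℕ.^ k ℕ.≤ n → ι k * ½ * ½ ∈ Below (log n)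
  log-below {k} {n} 1≤k 2^k≤n = inj₂ (ι k * ½ ,
    (0≤ι½ k , λ N → ≤-trans (expSum-half≤2^ k N) (ι-mono-≤ 2^k≤n)) ,
    half< (<-≤-trans (*-monoˡ-<-pos ½ (ι-mono-< {0} {1} (ℕ.s≤s ℕ.z≤n))) (*-monoʳ-≤-nonNeg ½ (ι-mono-≤ 1≤k))))

  -- 65536 = 2 · (2 · 2)⁷ · 2 undoes the halvings.
  bound-below : ∀ {m n} κ → 8 ℕ.^ m ℕ.≤ n → 2 ℕ.^ suc m ℕ.≤ n →
    ι (2 ℕ.^ m ℕ.* suc m ℕ.^ 7 ℕ.* κ) ∈ Below (fromℕ (suc (κ ℕ.* 65536)) *ʳ cbrt n *ʳ log n ^ʳ 7)
  bound-below {m} {n} κ 8^m≤n 2^≤n = subst (_∈ Below (fromℕ C *ʳ cbrt n *ʳ log n ^ʳ 7)) (sym equation)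
    (*ʳ-below {fromℕ C *ʳ cbrt n} {log n ^ʳ 7}
      (*-nonNeg (0≤ι (κ ℕ.* 65536)) (0≤ι½ (2 ℕ.^ m)))
      (*ʳ-below {fromℕ C} {cbrt n} (0≤ι (κ ℕ.* 65536)) (inj₂ (ι C , refl , ι-mono-< (ℕ.n<1+n (κ ℕ.* 65536))))
        (0≤ι½ (2 ℕ.^ m)) (cbrt-below {m} 8^m≤n))
      (proj₂ logs) (proj₁ logs))
    where
    -- The `suc` puts κ · 65536 strictly below the constant.
    C = suc (κ ℕ.* 65536)
    logs = ^ʳ-below {log n} 7 (*-nonNeg (0≤ι½ (suc m)) (nonNegative⁻¹ ½)) (log-below {suc m} (ℕ.s≤s ℕ.z≤n) 2^≤n)
    A B K : ℚ
    A = ι (2 ℕ.^ m)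
    B = ι (suc m)
    K = ι κ
    quarter : B * ½ * ½ ≡ B * (½ * ½)
    quarter = *-assoc B ½ ½
    equation : ι (2 ℕ.^ m ℕ.* suc m ℕ.^ 7 ℕ.* κ) ≡ ι (κ ℕ.* 65536) * (A * ½) * ((B * ½ * ½) ^ 7 * ½)
    equation = begin
      ι (2 ℕ.^ m ℕ.* suc m ℕ.^ 7 ℕ.* κ)    ≡⟨ ι-* (2 ℕ.^ m ℕ.* suc m ℕ.^ 7) κ ⟩
      ι (2 ℕ.^ m ℕ.* suc m ℕ.^ 7) * K      ≡⟨ cong (_* K) (ι-* (2 ℕ.^ m) (suc m ℕ.^ 7)) ⟩
      A * ι (suc m ℕ.^ 7) * K              ≡⟨ cong (λ x → A * x * K) (ι-^ (suc m) 7) ⟨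
      A * B ^ 7 * K                        ≡⟨ *-identityʳ _ ⟨
      A * B ^ 7 * K * (ι 65536 * ½ * (½ * ½) ^ 7 * ½) ≡⟨ l A (B ^ 7) K (ι 65536) ½ ((½ * ½) ^ 7) ⟩
      K * ι 65536 * (A * ½) * (B ^ 7 * (½ * ½) ^ 7 * ½) ≡⟨ cong₂ (λ x y → x * (A * ½) * (y * ½)) (ι-* κ 65536) (trans (cong (_^ 7) quarter) (^-distrib-* B (½ * ½) 7)) ⟨
      ι (κ ℕ.* 65536) * (A * ½) * ((B * ½ * ½) ^ 7 * ½) ∎
      where
      open ≡-Reasoning
      l : ∀ a b k c h q → a * b * k * (c * h * q * h) ≡ k * c * (a * h) * (b * q * h)
      l = solve 6 (λ a b k c h q → a :* b :* k :* (c :* h :* q :* h) := k :* c :* (a :* h) :* (b :* q :* h)) refl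
        where open +-*-Solver

-- From the bound in ℕ to the bound in real numbers.

open import Defs
open import Data.Bool using (Bool)
open import Data.Nat using (ℕ; zero; suc; _≤_; _<_; _^_; _*_; s≤s; z≤n)
open import Data.Nat.Properties using (≤-trans; ^-monoʳ-≤; m≤m+n; ^-*-assoc; +-suc; ≤-reflexive)
open import Data.Product using (Σ-syntax; ∃-syntax; _×_; _,_)
open import Data.Sum using (inj₂)
open import Data.Vec using (Vec)
open import Relation.Binary.PropositionalEquality using (_≢_; refl; sym)
open import Relation.Nullary using (¬_)
open Automata using (separation; floor-log)
open RealBounds using (ι; ι-mono-≤; ι-mono-<; bound-below; fromℕ-≤ʳ)

-- Lets `log n` pay for the factors `suc m`. For m = 0 it is n ≥ 2 that keeps the logarithm away
-- from 0.
2^[1+m]≤ : ∀ m {n} → 2 ≤ n → 8 ^ m ≤ n → 2 ^ suc m ≤ n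
2^[1+m]≤ zero    2≤n 8^m≤n = 2≤n
2^[1+m]≤ (suc m) 2≤n 8^m≤n = ≤-trans (^-monoʳ-≤ 2 1+m≤) (≤-trans (≤-reflexive (sym (^-*-assoc 2 3 (suc m)))) 8^m≤n)
  where
  1+m≤ : suc (suc m) ≤ 3 * suc m
  1+m≤ = s≤s (≤-trans (s≤s (m≤m+n m _)) (≤-reflexive (sym (+-suc m _))))

theorem1 : Σ[ C ∈ ℝ≥0 ] (Positiveʳ C × ((n : ℕ) → 2 ≤ n → (x y : Vec Bool n) → x ≢ y →
    Σ[ M ∈ DFA ] (fromℕ (DFA.∣Q∣ M) ≤ʳ C *ʳ cbrt n *ʳ log n ^ʳ 7 × Accepts M x × ¬ Accepts M y)))
theorem1 = assemble 380160 separation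
  where
  assemble : ∀ κ → (∀ m n → n < 8 ^ suc m → (x y : Vec Bool n) → x ≢ y →
      Σ[ M ∈ DFA ] (DFA.∣Q∣ M ≤ 2 ^ m * suc m ^ 7 * κ × Accepts M x × ¬ Accepts M y)) →
    Σ[ C ∈ ℝ≥0 ] (Positiveʳ C × ((n : ℕ) → 2 ≤ n → (x y : Vec Bool n) → x ≢ y →
      Σ[ M ∈ DFA ] (fromℕ (DFA.∣Q∣ M) ≤ʳ C *ʳ cbrt n *ʳ log n ^ʳ 7 × Accepts M x × ¬ Accepts M y)))
  assemble κ separation = C , inj₂ (ι (suc (κ * 65536)) , refl , ι-mono-< {0} {suc (κ * 65536)} (s≤s z≤n)) , λ n 2≤n x y x≢y →
    let m , 8^m≤n , n< = floor-log 8 (s≤s (s≤s z≤n)) n (≤-trans (s≤s z≤n) 2≤n)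
        M , ∣Q∣≤ , acc , rej = separation m n n< x y x≢y
    in M , fromℕ-≤ʳ {DFA.∣Q∣ M} {C *ʳ cbrt n *ʳ log n ^ʳ 7} (ι-mono-≤ ∣Q∣≤)
             (bound-below {m} κ 8^m≤n (2^[1+m]≤ m 2≤n 8^m≤n)) , acc , rej
    where
    C : ℝ≥0
    C = fromℕ (suc (κ * 65536))
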